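{- For every integer $k\ge 2$ there exists a constant $C_k$ such that $\mathrm{L}^{(k)}(n)\le t_k(n^{C_k})$ holds for every positive integer $n$.
   Context: For a natural number $N$ let $[N]=\{1,\dots,N\}$, and for a set $X$ let $X^{(k)}$ be the set of all $k$-element subsets of $X$. The tower functions are defined by $t_0(x)=x$ and $t_{i+1}(x)=2^{t_i(x)}$. An ordering means a (strict) linear ordering. For a set $X$ of integers, an ordering $(X^{(k)},\prec)$ is canonical if for any two (finite) sets $A,B\subseteq X$ of the same size the order-preserving map from $A$ to $B$ (with respect to the usual order of the integers) induces an order-preserving map from $(A^{(k)},\prec)$ to $(B^{(k)},\prec)$. For positive integers $k,n$, $\mathrm{L}^{(k)}(n)$ denotes the least integer such that for every $N\ge \mathrm{L}^{(k)}(n)$ and every ordering $([N]^{(k)},\prec)$ there is a set $X\subseteq[N]$ of size $n$ such that $(X^{(k)},\prec)$ is canonical. (Its existence is a theorem of Leeb.) -}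

module Defs where

open import Data.Fin using (Fin; _<_)
open import Data.Fin.Subset using (Subset; _∈_; _⊆_; ∣_∣)
open import Data.Nat using (ℕ; zero; suc; _^_; _≤_)
open import Data.Product using (Σ; ∃-syntax; _×_; proj₁)
open import Function.Bundles using (_⇔_)
open import Level using (0ℓ)
open import Relation.Binary.Core using (Rel)
open import Relation.Binary.Structures using (IsStrictTotalOrder)
open import Relation.Binary.PropositionalEquality using (_≡_)

tower : ℕ → ℕ → ℕ
tower zero    x = x
tower (suc i) x = 2 ^ tower i x

-- The ground set [N] = {1,…,N} is represented by Fin N with its usual order.
-- The cardinality proof is irrelevant (ℕ is a set), so _≡_ on this type is
-- equality of the underlying subsets.
KSubset : ℕ → ℕ → Set
KSubset k N = Σ (Subset N) λ S → ∣ S ∣ ≡ k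

-- Only the values of f on A matter: f represents a map A → B.  When
-- ∣ A ∣ ≡ ∣ B ∣ such a map is a bijection and is unique on A.
record OrderPreserving {N : ℕ} (A B : Subset N) (f : Fin N → Fin N) : Set where
  field
    maps-into : ∀ {x} → x ∈ A → f x ∈ B
    monotone  : ∀ {x y} → x ∈ A → y ∈ A → x < y → f x < f y

IsImage : {N : ℕ} → (Fin N → Fin N) → Subset N → Subset N → Set
IsImage f S T = ∀ y → y ∈ T ⇔ (∃[ x ] (x ∈ S × f x ≡ y))

-- (X^(k), ≺) is canonical, where ≺ is an ordering of [N]^(k) restricted to the
-- k-subsets of X.  T and T′ are the images f(S) and f(S′); as f is injective
-- on A, these images exist, are unique, and have size k.
Canonical : {k N : ℕ} → Rel (KSubset k N) 0ℓ → Subset N → Set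
Canonical {k} {N} _≺_ X =
  (A B : Subset N) → A ⊆ X → B ⊆ X → ∣ A ∣ ≡ ∣ B ∣ →
  (f : Fin N → Fin N) → OrderPreserving A B f →
  (S S′ T T′ : KSubset k N) → proj₁ S ⊆ A → proj₁ S′ ⊆ A →
  IsImage f (proj₁ S) (proj₁ T) → IsImage f (proj₁ S′) (proj₁ T′) →
  S ≺ S′ → T ≺ T′

-- M is a threshold beyond which canonical n-sets always exist.
LeebBound : ℕ → ℕ → ℕ → Set₁
LeebBound k n M =
  ∀ N → M ≤ N →
  (_≺_ : Rel (KSubset k N) 0ℓ) → IsStrictTotalOrder _≡_ _≺_ →
  ∃[ X ] (∣ X ∣ ≡ n × Canonical _≺_ X)

-- L = L^(k)(n).  The number is given by its defining property, since defining
-- it as a function would presuppose Leeb's theorem.  For n ≥ 1 the least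
-- integer is a natural number because [0] has no subset of size n.
record IsLeebNumber (k n L : ℕ) : Set₁ where
  field
    bound : LeebBound k n L
    least : ∀ M → LeebBound k n M → L ≤ M

{-# OPTIONS --safe #-}
module Submission where

open import Defs
open import Data.Bool using (Bool; true; false; not; T; T?)
import Data.Bool.Properties as Bool
open import Data.Empty using (⊥; ⊥-elim)
open import Data.Fin as Fin using (Fin; zero; suc)
import Data.Fin.Properties as Fin
open import Data.Fin.Subset using (Subset; _⊆_; ∣_∣; ⁅_⁆) renaming (_∈_ to _∈ₛ_)
import Data.Fin.Subset.Properties as Subset
open import Data.List using (List; []; _∷_; _++_; length; map; filter; cartesianProductWith; cartesianProduct; allFin; upTo)
import Data.List.Properties as List
open import Data.List.Membership.Propositional using (_∈_; _∉_; find)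
open import Data.List.Membership.Propositional.Properties
open import Data.List.Relation.Unary.All as All using ([]; _∷_)
import Data.List.Relation.Unary.All.Properties as All
open import Data.List.Relation.Unary.AllPairs as AllPairs using (AllPairs; []; _∷_)
import Data.List.Relation.Unary.AllPairs.Properties as AllPairs
open import Data.List.Relation.Unary.Any using (here; there)
open import Data.Nat
open import Data.Nat.Properties
open import Data.Nat.Tactic.RingSolver using (solve-∀)
open import Data.Product using (∃-syntax; _×_; _,_; proj₁; proj₂)
open import Data.Sum using (_⊎_; inj₁; inj₂; [_,_]′)
open import Data.Unit using (⊤; tt)
open import Data.Vec as Vec using (Vec; []; _∷_; lookup; _[_]≔_)
import Data.Vec.Properties as Vec
open import Function using (_∘_; id; flip)
open import Function.Bundles using (_⇔_; mk⇔; Equivalence)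
open import Level using (0ℓ)
open import Relation.Binary using (IsStrictTotalOrder; Rel; Tri; tri<; tri≈; tri>)
import Relation.Binary.Construct.Add.Infimum.Strict as Infimum
import Relation.Binary.Construct.Flip.EqAndOrd as Flip
open import Relation.Binary.PropositionalEquality
open import Relation.Binary.Structures.Biased using (isStrictTotalOrderᶜ)
open import Relation.Nullary using (Dec; yes; no; ¬_; ¬?; does; contradiction; _→-dec_; _×-dec_; _⊎-dec_)
open import Relation.Nullary.Construct.Add.Infimum using (_₋; ⊥₋; [_]; []-injective)
import Relation.Nullary.Decidable as Dec

-- The ordering F of the k-tuples is canonised by induction on k, each step
-- costing one exponential.  An Erdős–Rado tree produces points B and a last
-- point w such that comparisons of F (z ∷ S) with tuples below z do not depend
-- on z, so that G S = F (w ∷ S) orders the (k-1)-tuples.  Suppose G is already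
-- lexicographic.  Then F is lexicographic as well, with the last coordinate
-- inserted in front of the first position p at which F (z ∷ S) passes G T for
-- tuples S, T that differ only at p.  Whether this happens is, for fixed S and
-- T, a condition z < threshold; so along with the ordering one makes finitely
-- many functions f of k+1 variables uniform: v < f Q has the same truth value
-- for all Q below v.  Treating this as a colouring of (k+2)-tuples would cost
-- one exponential too many.  Instead the tree also records the binary scale of
-- f (z ∷ S) - z (logarithmically many colours) and makes the scales of the
-- differences between its own points decrease; then v < f (z ∷ S) for z < v
-- becomes again a threshold condition on z, with a threshold that depends on
-- S only.  For k = 0 uniformity costs only a power of n.
--
-- The least bound is a natural number because, for fixed N, all orderings can
-- be searched exhaustively.

-- Sizes are nearly circular: scales are taken of positions in `Z`, so the number of colours grows
-- with the logarithm of `length Z`, while the length that the tree needs grows with the number of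
-- colours. It closes because colours count only through their logarithm. With `length Z` equal to 2
-- ^ (D * D) there are D * D + 3 ≤ 2 ^ D colours, each of the at most `used` active colourings costs
-- a factor 2 ^ D per point, and `suc used * suc m ≤ D` suffices. As `used` is polynomial in `m`, so
-- is D, and the step costs a single exponential. The other obstacle is that passing or not passing
-- is known only for tuples that differ at one position, while a lexicographic comparison leaves all
-- later positions open.

infix 4 _⊑_
_⊑_ : List ℕ → List ℕ → Set
xs ⊑ ys = ∀ {x} → x ∈ xs → x ∈ ys

Asc : List ℕ → Set
Asc = AllPairs _<_

-- Binary scales

-- The number of halvings after which two numbers coincide, cut off at the
-- first argument: an ultrametric on ℕ that is compatible with the order.
sep : ℕ → ℕ → ℕ → ℕ
sep zero    x y = 0
sep (suc L) x y with x ≟ y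
... | yes _ = 0
... | no  _ = suc (sep L ⌊ x /2⌋ ⌊ y /2⌋)

sep≤ : ∀ L x y → sep L x y ≤ L
sep≤ zero    x y = z≤n
sep≤ (suc L) x y with x ≟ y
... | yes _ = z≤n
... | no  _ = s≤s (sep≤ L _ _)

sep-refl : ∀ L x → sep L x x ≡ 0
sep-refl zero    x = refl
sep-refl (suc L) x with x ≟ x
... | yes _   = refl
... | no  x≢x = contradiction refl x≢x

sep-suc : ∀ L {x y} → x < y → sep (suc L) x y ≡ suc (sep L ⌊ x /2⌋ ⌊ y /2⌋)
sep-suc L {x} {y} x<y with x ≟ y
... | yes refl = contradiction x<y (<-irrefl refl)
... | no  _    = refl

half-bound : ∀ {L x} → x < 2 ^ suc L → ⌊ x /2⌋ < 2 ^ L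
half-bound {L} {x} x< with ⌊ x /2⌋ <? 2 ^ L
... | yes p = p
... | no ¬p = contradiction x< (≤⇒≯ (begin
  2 ^ L + (2 ^ L + 0)     ≡⟨ cong (2 ^ L +_) (+-identityʳ _) ⟩
  2 ^ L + 2 ^ L           ≤⟨ +-mono-≤ (≮⇒≥ ¬p) (≮⇒≥ ¬p) ⟩
  ⌊ x /2⌋ + ⌊ x /2⌋       ≤⟨ +-monoʳ-≤ ⌊ x /2⌋ (⌊n/2⌋≤⌈n/2⌉ x) ⟩
  ⌊ x /2⌋ + ⌈ x /2⌉       ≡⟨ ⌊n/2⌋+⌈n/2⌉≡n x ⟩
  x                       ∎))
  where open ≤-Reasoning

half-cancel-< : ∀ {x y} → ⌊ x /2⌋ < ⌊ y /2⌋ → x < y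
half-cancel-< {x} {y} p with x <? y
... | yes q = q
... | no ¬q = contradiction p (≤⇒≯ (⌊n/2⌋-mono (≮⇒≥ ¬q)))

three-halves : ∀ {x y z} → x < y → y < z → ⌊ x /2⌋ < ⌊ z /2⌋
three-halves {x} x<y y<z =
  ⌊n/2⌋-mono {suc (suc x)} (≤-trans (s≤s x<y) y<z)

sep≡0 : ∀ L {x y} → x < 2 ^ L → y < 2 ^ L → sep L x y ≡ 0 → x ≡ y
sep≡0 zero    x< y< _ = trans (n<1⇒n≡0 x<) (sym (n<1⇒n≡0 y<))
sep≡0 (suc L) {x} {y} x< y< e with x ≟ y | e
... | yes p | _  = p
... | no  _ | ()

-- Some dyadic block contains `z` and `a` but not `b`; as `b` exceeds `z`, it lies to the right of
-- the whole block.
sep-< : ∀ L {z a b} → z < a → z < b → sep L z a < sep L z b → a < b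
sep-< zero    _ _ ()
sep-< (suc L) {z} {a} {b} z<a z<b p
  rewrite sep-suc L z<a | sep-suc L z<b
  with ⌊ z /2⌋ ≟ ⌊ a /2⌋ | m≤n⇒m<n∨m≡n (⌊n/2⌋-mono (<⇒≤ z<b))
... | _      | inj₂ e  rewrite sym e | sep-refl L ⌊ z /2⌋ = contradiction (s≤s⁻¹ p) λ ()
... | yes e  | inj₁ q  = half-cancel-< (subst (_< _) e q)
... | no ne  | inj₁ q  = half-cancel-<
  (sep-< L (≤∧≢⇒< (⌊n/2⌋-mono (<⇒≤ z<a)) ne) q (s≤s⁻¹ p))

-- At the highest bit where `z` and `v` differ, `v` has a 1; at the highest bit where `v` and `f`
-- differ, it has a 0. So these are different bits, and the bound on `f` keeps both within the
-- cut-off.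
sep-chain : ∀ L {z v f} → f < 2 ^ L → z < v → v < f → sep L z v ≢ sep L v f
sep-chain zero    f< z<v v<f _ = contradiction (≤-trans (s≤s (≤-trans z<v (<⇒≤ v<f))) f<) λ { (s≤s ()) }
sep-chain (suc L) {z} {v} {f} f< z<v v<f e
  rewrite sep-suc L z<v | sep-suc L v<f
  with m≤n⇒m<n∨m≡n (⌊n/2⌋-mono (<⇒≤ z<v)) | m≤n⇒m<n∨m≡n (⌊n/2⌋-mono (<⇒≤ v<f))
... | inj₁ p | inj₁ q = sep-chain L (half-bound {L} f<) p q (suc-injective e)
... | inj₂ p | inj₂ q = <-irrefl (trans p q) (three-halves z<v v<f)
... | inj₁ p | inj₂ q = <-irrefl (sep≡0 L (<-≤-trans p (<⇒≤ v/2<)) v/2<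
        (trans (suc-injective e) (trans (cong (sep L _) (sym q)) (sep-refl L _)))) p
  where v/2< = half-bound {L} (<-trans v<f f<)
... | inj₂ p | inj₁ q = <-irrefl (sep≡0 L (<-≤-trans q (<⇒≤ f/2<)) f/2<
        (trans (sym (suc-injective e)) (trans (cong (sep L _) (sym p)) (sep-refl L _)))) q
  where f/2< = half-bound {L} f<

-- Both `v` and `w` have a 1 at the highest bit where they differ from `z` and agree with `z` above
-- it, so they can differ from each other only at lower bits.
sep-decreasing : ∀ L {z v w} → v < 2 ^ L → w < 2 ^ L → z < v → z < w →
                 sep L z v ≡ sep L z w → sep L v w < sep L z w
sep-decreasing zero    v< _ z<v _ _ = contradiction (≤-trans (s≤s z<v) v<) λ { (s≤s ()) }
sep-decreasing (suc L) {z} {v} {w} v< w< z<v z<w e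
  rewrite sep-suc L z<v | sep-suc L z<w
  with v ≟ w
... | yes _  = z<s
... | no  v≢w
  with m≤n⇒m<n∨m≡n (⌊n/2⌋-mono (<⇒≤ z<v)) | m≤n⇒m<n∨m≡n (⌊n/2⌋-mono (<⇒≤ z<w))
... | inj₁ p | inj₁ q = s≤s (sep-decreasing L (half-bound {L} v<) (half-bound {L} w<) p q (suc-injective e))
... | inj₁ p | inj₂ q = contradiction (sep≡0 L (<-≤-trans p (<⇒≤ (half-bound {L} v<))) (half-bound {L} v<)
      (trans (suc-injective e) (trans (cong (sep L _) (sym q)) (sep-refl L _)))) (<⇒≢ p)
... | inj₂ p | inj₁ q = contradiction (sep≡0 L (<-≤-trans q (<⇒≤ (half-bound {L} w<))) (half-bound {L} w<)
      (trans (sym (suc-injective e)) (trans (cong (sep L _) (sym p)) (sep-refl L _)))) (<⇒≢ q)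
... | inj₂ p | inj₂ q with <-cmp v w
...   | tri< v<w _ _ = contradiction q (<⇒≢ (three-halves z<v v<w))
...   | tri≈ _ v≡w _ = contradiction v≡w v≢w
...   | tri> _ _ w<v = contradiction p (<⇒≢ (three-halves z<w w<v))

-- End-homogeneous sets

length-filter-cover : ∀ {P Q : ℕ → Set} (P? : ∀ x → Dec (P x)) (Q? : ∀ x → Dec (Q x)) (xs : List ℕ) →
  (∀ {x} → x ∈ xs → P x ⊎ Q x) → length xs ≤ length (filter P? xs) + length (filter Q? xs)
length-filter-cover P? Q? []       h = z≤n
length-filter-cover P? Q? (x ∷ xs) h
  with P? x | Q? x | length-filter-cover P? Q? xs (h ∘ there)
... | yes _ | yes _ | ih = s≤s (≤-trans ih (+-monoʳ-≤ _ (n≤1+n _)))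
... | yes _ | no  _ | ih = s≤s ih
... | no  _ | yes _ | ih = ≤-trans (s≤s ih) (≤-reflexive (sym (+-suc _ _)))
... | no ¬p | no ¬q | _  = ⊥-elim ([ ¬p , ¬q ]′ (h (here refl)))

length-filter-filter : ∀ {P Q : ℕ → Set} (P? : ∀ x → Dec (P x)) (Q? : ∀ x → Dec (Q x)) (xs : List ℕ) →
  length (filter P? (filter Q? xs)) ≤ length (filter P? xs)
length-filter-filter P? Q? [] = z≤n
length-filter-filter P? Q? (x ∷ xs) with Q? x
... | yes _ with P? x
...   | yes _ = s≤s (length-filter-filter P? Q? xs)
...   | no  _ = length-filter-filter P? Q? xs
length-filter-filter P? Q? (x ∷ xs) | no _ with P? x
...   | yes _ = m≤n⇒m≤1+n (length-filter-filter P? Q? xs)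
...   | no  _ = length-filter-filter P? Q? xs

class : (ℕ → ℕ) → ℕ → List ℕ → List ℕ
class c a = filter (λ z → c z ≟ a)

pigeonhole : ∀ K (c : ℕ → ℕ) (Z : List ℕ) → (∀ {z} → z ∈ Z → c z < K) →
             ∃[ a ] length Z ≤ K * length (class c a Z)
pigeonhole zero    c []      _ = 0 , z≤n
pigeonhole zero    c (z ∷ Z) h = contradiction (h (here refl)) λ ()
pigeonhole (suc K) c Z h
  with pigeonhole K c (filter (λ z → c z <? K) Z) (λ z∈ → proj₂ (∈-filter⁻ (λ z → c z <? K) {xs = Z} z∈))
... | a , p = pick (≤-total (length (class c a Z)) (length (class c K Z)))
  where
  open ≤-Reasoning
  split : length Z ≤ length (class c K Z) + K * length (class c a Z)
  split = begin
    length Z ≤⟨ length-filter-cover (λ z → c z ≟ K) (λ z → c z <? K) Z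
                  (λ z∈ → [ inj₂ , inj₁ ]′ (m≤n⇒m<n∨m≡n (s≤s⁻¹ (h z∈)))) ⟩
    length (class c K Z) + length (filter (λ z → c z <? K) Z)
      ≤⟨ +-monoʳ-≤ _ (≤-trans p (*-monoʳ-≤ K (length-filter-filter (λ z → c z ≟ a) (λ z → c z <? K) Z))) ⟩
    length (class c K Z) + K * length (class c a Z) ∎
  pick : length (class c a Z) ≤ length (class c K Z) ⊎ length (class c K Z) ≤ length (class c a Z) →
         ∃[ a ] length Z ≤ suc K * length (class c a Z)
  pick (inj₁ q) = K , ≤-trans split (+-monoʳ-≤ (length (class c K Z)) (*-monoʳ-≤ K q))
  pick (inj₂ q) = a , ≤-trans split (+-monoˡ-≤ (K * length (class c a Z)) q)

ConstantOn : List ℕ → (ℕ → ℕ) → Set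
ConstantOn Z c = ∀ {x y} → x ∈ Z → y ∈ Z → c x ≡ c y

refine : ∀ K (cs : List (ℕ → ℕ)) (Z : List ℕ) → Asc Z → (∀ {c} → c ∈ cs → ∀ z → c z < K) →
         ∃[ Z′ ] Z′ ⊑ Z × Asc Z′ × (∀ {c} → c ∈ cs → ConstantOn Z′ c) × length Z ≤ K ^ length cs * length Z′
refine K []       Z asc h = Z , id , asc , (λ ()) , ≤-reflexive (sym (+-identityʳ _))
refine K (c ∷ cs) Z asc h
  with pigeonhole K c Z (λ {z} _ → h (here refl) z)
... | a , p with refine K cs (class c a Z) (AllPairs.filter⁺ _ asc) (h ∘ there)
...   | Z′ , sub , asc′ , const , q = Z′ , proj₁ ∘ back , asc′ ,
        (λ { (here refl) x∈ y∈ → trans (proj₂ (back x∈)) (sym (proj₂ (back y∈)))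
           ; (there c∈) → const c∈ }) ,
        (begin
          length Z                              ≤⟨ p ⟩
          K * length (class c a Z)              ≤⟨ *-monoʳ-≤ K q ⟩
          K * (K ^ length cs * length Z′)       ≡⟨ *-assoc K _ _ ⟨
          K * K ^ length cs * length Z′         ∎)
  where
  open ≤-Reasoning
  back : ∀ {x} → x ∈ Z′ → x ∈ Z × c x ≡ a
  back x∈ = ∈-filter⁻ (λ z → c z ≟ a) {xs = Z} (sub x∈)

lists : ℕ → List ℕ → List (List ℕ)
lists zero    P = [] ∷ []
lists (suc a) P = [] ∷ cartesianProductWith _∷_ P (lists a P)

∈-lists : ∀ {a P} (l : List ℕ) → length l ≤ a → l ⊑ P → l ∈ lists a P
∈-lists {zero}  []      _ _ = here refl
∈-lists {suc a} []      _ _ = here refl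
∈-lists {suc a} (x ∷ l) (s≤s p) h =
  there (∈-cartesianProductWith⁺ _∷_ (h (here refl)) (∈-lists l p (h ∘ there)))

length-cartesianProductWith : ∀ {A B C : Set} (f : A → B → C) (xs : List A) (ys : List B) →
  length (cartesianProductWith f xs ys) ≡ length xs * length ys
length-cartesianProductWith f []       ys = refl
length-cartesianProductWith f (x ∷ xs) ys = trans (List.length-++ (map (f x) ys))
  (cong₂ _+_ (List.length-map (f x) ys) (length-cartesianProductWith f xs ys))

length-lists : ∀ a P → length (lists a P) ≤ suc (length P) ^ a
length-lists zero    P = ≤-refl
length-lists (suc a) P = begin
  suc (length (cartesianProductWith _∷_ P (lists a P)))  ≡⟨ cong suc (length-cartesianProductWith _∷_ P (lists a P)) ⟩
  suc (length P * length (lists a P))                    ≤⟨ +-mono-≤ (m^n>0 (suc (length P)) a) (*-monoʳ-≤ (length P) (length-lists a P)) ⟩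
  suc (length P) ^ a + length P * suc (length P) ^ a     ∎
  where open ≤-Reasoning

-- Colouring of z relative to two short lists of elements below z.
Colouring : Set
Colouring = List ℕ → List ℕ → ℕ → ℕ

module EndHomogeneous (K a w M : ℕ) (cols : List Colouring)
  (bounded : ∀ {c} → c ∈ cols → ∀ l l′ z → c l l′ z < K)
  (few : K ^ (length cols * (suc M ^ a * suc M ^ a)) ≤ 2 ^ w) (K>0 : 0 < K) where

  active : List ℕ → List (ℕ → ℕ)
  active P = cartesianProductWith (λ c ll → c (proj₁ ll) (proj₂ ll)) cols (cartesianProduct (lists a P) (lists a P))

  ∈-active : ∀ {P c l l′} → c ∈ cols → length l ≤ a → length l′ ≤ a → l ⊑ P → l′ ⊑ P → c l l′ ∈ active P
  ∈-active c∈ p p′ h h′ = ∈-cartesianProductWith⁺ _ c∈ (∈-cartesianProduct⁺ (∈-lists _ p h) (∈-lists _ p′ h′))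

  active-bounded : ∀ {P c} → c ∈ active P → ∀ z → c z < K
  active-bounded {P} c∈ z with ∈-cartesianProductWith⁻ _ cols (cartesianProduct (lists a P) (lists a P)) c∈
  ... | c , (l , l′) , c∈cols , _ , refl = bounded c∈cols l l′ z

  active-few : ∀ P → length P ≤ M → K ^ length (active P) ≤ 2 ^ w
  active-few P p = ≤-trans (^-monoʳ-≤ K {{>-nonZero K>0}} (begin
    length (active P) ≡⟨ length-cartesianProductWith _ cols _ ⟩
    length cols * length (cartesianProduct (lists a P) (lists a P)) ≡⟨ cong (length cols *_) (length-cartesianProductWith _ (lists a P) _) ⟩
    length cols * (length (lists a P) * length (lists a P)) ≤⟨ *-monoʳ-≤ (length cols) (*-mono-≤ bd bd) ⟩
    length cols * (suc M ^ a * suc M ^ a) ∎)) few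
    where
    open ≤-Reasoning
    bd : length (lists a P) ≤ suc M ^ a
    bd = ≤-trans (length-lists a P) (^-monoˡ-≤ a (s≤s p))

  -- One branch of the Erdős-Rado tree, with `P` the points chosen before. The class is constant
  -- including its first point `y`, so `y` has the same colours over `P` as all points after it.
  data Tree : List ℕ → List ℕ → Set where
    []  : ∀ {P} → Tree P []
    _∷_ : ∀ {P y ys} → (∀ {c} → c ∈ active P → ConstantOn (y ∷ ys) c) → Tree (y ∷ P) ys → Tree P (y ∷ ys)

  -- Each point costs a factor 2 ^ w for making the active colourings constant, and a factor 2 that
  -- pays for removing the point itself.
  grow : ∀ j P Z → Asc Z → length P + j ≤ M → 2 ^ (suc w * j) ≤ length Z →
         ∃[ Y ] Y ⊑ Z × Asc Y × length Y ≡ j × Tree P Y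
  grow zero    P Z asc _ _ = [] , (λ ()) , [] , refl , []
  grow (suc j) P Z asc p q with refine K (active P) Z asc active-bounded
  ... | Z′ , sub , asc′ , const , r = go Z′ sub asc′ const big
    where
    open ≤-Reasoning
    big : 2 * 2 ^ (suc w * j) ≤ length Z′
    big = *-cancelˡ-≤ (2 ^ w) {{>-nonZero (m^n>0 2 w)}} (begin
      2 ^ w * (2 * 2 ^ (suc w * j))  ≡⟨ *-assoc (2 ^ w) 2 _ ⟨
      2 ^ w * 2 * 2 ^ (suc w * j)    ≡⟨ cong (_* 2 ^ (suc w * j)) (*-comm (2 ^ w) 2) ⟩
      2 ^ suc w * 2 ^ (suc w * j)    ≡⟨ ^-distribˡ-+-* 2 (suc w) (suc w * j) ⟨
      2 ^ (suc w + suc w * j)        ≡⟨ cong (2 ^_) (*-suc (suc w) j) ⟨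
      2 ^ (suc w * suc j)            ≤⟨ q ⟩
      length Z                       ≤⟨ r ⟩
      K ^ length (active P) * length Z′ ≤⟨ *-monoˡ-≤ (length Z′) (active-few P (≤-trans (m≤m+n _ _) p)) ⟩
      2 ^ w * length Z′              ∎)
    go : ∀ Z′ → Z′ ⊑ Z → Asc Z′ → (∀ {c} → c ∈ active P → ConstantOn Z′ c) → 2 * 2 ^ (suc w * j) ≤ length Z′ →
         ∃[ Y ] Y ⊑ Z × Asc Y × length Y ≡ suc j × Tree P Y
    go []      _   _              _     b = contradiction b (<⇒≱ (≤-trans (m^n>0 2 (suc w * j)) (m≤m+n _ _)))
    go (y ∷ Z″) sub (y< ∷ asc″) const b
      with grow j (y ∷ P) Z″ asc″ (≤-trans (≤-reflexive (sym (+-suc (length P) j))) p)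
             (s≤s⁻¹ (≤-trans (+-mono-≤ (m^n>0 2 (suc w * j)) (m≤m+n _ 0)) b))
    ... | Y , subY , ascY , lenY , tree =
      y ∷ Y , (λ { (here refl) → sub (here refl) ; (there i) → sub (there (subY i)) }) ,
      All.tabulate (λ i → All.lookup y< (subY i)) ∷ ascY , cong suc lenY ,
      (λ c∈ i i′ → const c∈ (up i) (up i′)) ∷ tree
      where
      up : ∀ {x} → x ∈ y ∷ Y → x ∈ y ∷ Z″
      up (here e)  = here e
      up (there i) = there (subY i)

  -- By descent along the branch to the earlier of `z` and `z′`. The entries of `l` and `l′` are
  -- smaller, hence already in `P`, so the colouring is among those made constant when that point
  -- was chosen.
  homogeneous′ : ∀ {P Y c l l′ z z′} → Asc Y → Tree P Y → c ∈ cols → length l ≤ a → length l′ ≤ a →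
    (∀ {x} → x ∈ l → x ∈ P ⊎ x ∈ Y) → (∀ {x} → x ∈ l′ → x ∈ P ⊎ x ∈ Y) → z ∈ Y → z′ ∈ Y →
    (∀ {x} → x ∈ l → x < z × x < z′) → (∀ {x} → x ∈ l′ → x < z × x < z′) → c l l′ z ≡ c l l′ z′
  homogeneous′ {P} {y ∷ ys} {c} {l} {l′} {z} {z′} (y< ∷ asc) (const ∷ tree) c∈ p p′ h h′ z∈ z′∈ lt lt′ = go z∈ z′∈
    where
    minimal : ∀ {x v} → x ∈ P ⊎ x ∈ y ∷ ys → x < v → v ≡ y → x ∈ P
    minimal (inj₁ x∈P)          _   _    = x∈P
    minimal (inj₂ (here refl))  x<v refl = contradiction x<v (<-irrefl refl)
    minimal (inj₂ (there x∈ys)) x<v refl = contradiction (<-trans x<v (All.lookup y< x∈ys)) (<-irrefl refl)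
    move : ∀ {x} → x ∈ P ⊎ x ∈ y ∷ ys → x ∈ y ∷ P ⊎ x ∈ ys
    move (inj₁ i)         = inj₁ (there i)
    move (inj₂ (here e))  = inj₁ (here e)
    move (inj₂ (there i)) = inj₂ i
    go : z ∈ y ∷ ys → z′ ∈ y ∷ ys → c l l′ z ≡ c l l′ z′
    go (there i) (there i′) = homogeneous′ asc tree c∈ p p′ (move ∘ h) (move ∘ h′) i i′ lt lt′
    go (here e)  _          = const (∈-active c∈ p p′ (λ i → minimal (h i) (proj₁ (lt i)) e) (λ i → minimal (h′ i) (proj₁ (lt′ i)) e)) z∈ z′∈
    go (there _) (here e)   = const (∈-active c∈ p p′ (λ i → minimal (h i) (proj₂ (lt i)) e) (λ i → minimal (h′ i) (proj₂ (lt′ i)) e)) z∈ z′∈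

  endHomogeneous : ∀ Z → Asc Z → 2 ^ (suc w * M) ≤ length Z →
    ∃[ Y ] Y ⊑ Z × Asc Y × length Y ≡ M ×
      (∀ {c l l′ z z′} → c ∈ cols → length l ≤ a → length l′ ≤ a → l ⊑ Y → l′ ⊑ Y → z ∈ Y → z′ ∈ Y →
        (∀ {x} → x ∈ l → x < z × x < z′) → (∀ {x} → x ∈ l′ → x < z × x < z′) → c l l′ z ≡ c l l′ z′)
  endHomogeneous Z asc p with grow M [] Z asc ≤-refl p
  ... | Y , sub , ascY , len , tree = Y , sub , ascY , len ,
    λ c∈ p p′ h h′ → homogeneous′ ascY tree c∈ p p′ (inj₂ ∘ h) (inj₂ ∘ h′)

-- Sets of size k are represented by decreasing tuples, so that the last
-- coordinate in the sense of the order is the head.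
Desc : ∀ {k} → Vec ℕ k → Set
Desc S = ∀ {i j} → i Fin.< j → lookup S j < lookup S i

infix 4 _≫_ _⊏_
_≫_ : ∀ {k} → ℕ → Vec ℕ k → Set
z ≫ S = ∀ i → lookup S i < z

_⊏_ : ∀ {k} → Vec ℕ k → List ℕ → Set
S ⊏ X = ∀ i → lookup S i ∈ X

desc-∷ : ∀ {k z} {S : Vec ℕ k} → z ≫ S → Desc S → Desc (z ∷ S)
desc-∷ h d {zero}  {suc j} _       = h j
desc-∷ h d {suc i} {suc j} (s≤s p) = d p

desc-tail : ∀ {k z} {S : Vec ℕ k} → Desc (z ∷ S) → Desc S
desc-tail d p = d (s≤s p)

desc-head : ∀ {k z} {S : Vec ℕ k} → Desc (z ∷ S) → z ≫ S
desc-head d i = d {zero} {suc i} z<s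

⊏-∷ : ∀ {k z X} {S : Vec ℕ k} → z ∈ X → S ⊏ X → (z ∷ S) ⊏ X
⊏-∷ z∈ S∈ zero    = z∈
⊏-∷ z∈ S∈ (suc i) = S∈ i

≫-∷ : ∀ {k z y} {S : Vec ℕ k} → y < z → z ≫ S → z ≫ (y ∷ S)
≫-∷ p h zero    = p
≫-∷ p h (suc i) = h i

lookup-ext : ∀ {k} {S T : Vec ℕ k} → (∀ i → lookup S i ≡ lookup T i) → S ≡ T
lookup-ext {S = []}    {[]}    h = refl
lookup-ext {S = x ∷ S} {y ∷ T} h = cong₂ _∷_ (h zero) (lookup-ext (h ∘ suc))

-- Uniform functions, and the case of one variable

Big Small Uniform : ∀ {k} → (Vec ℕ k → ℕ) → List ℕ → Set
Big     f X = ∀ {Q v} → Desc Q → Q ⊏ X → v ∈ X → v ≫ Q → v < f Q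
Small   f X = ∀ {Q v} → Desc Q → Q ⊏ X → v ∈ X → v ≫ Q → f Q ≤ v
Uniform f X = Big f X ⊎ Small f X

uniform-⊑ : ∀ {k X Y} {f : Vec ℕ k → ℕ} → X ⊑ Y → Uniform f Y → Uniform f X
uniform-⊑ h (inj₁ u) = inj₁ λ d i v∈ v≫ → u d (h ∘ i) (h v∈) v≫
uniform-⊑ h (inj₂ u) = inj₂ λ d i v∈ v≫ → u d (h ∘ i) (h v∈) v≫

split-asc : ∀ n {X} → Asc X → n ≤ length X → ∃[ B ] ∃[ R ] Asc B × Asc R × B ⊑ X × R ⊑ X ×
  length B ≡ n × n + length R ≡ length X × (∀ {b r} → b ∈ B → r ∈ R → b < r)
split-asc zero    {X} asc _ = [] , X , [] , asc , (λ ()) , id , refl , refl , λ ()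
split-asc (suc n) {x ∷ X} (x< ∷ asc) (s≤s p) with split-asc n asc p
... | B , R , ascB , ascR , subB , subR , lenB , lenR , sep =
  x ∷ B , R , All.tabulate (All.lookup x< ∘ subB) ∷ ascB , ascR ,
  (λ { (here e) → here e ; (there i) → there (subB i) }) , there ∘ subR , cong suc lenB , cong suc lenR ,
  λ { (here refl) r∈ → All.lookup x< (subR r∈) ; (there i) r∈ → sep i r∈ }

-- The first `n` points either are big or contain `x` and `v` with `f (x ∷ [])` at most `v`. Then
-- `x` is kept and the rest of the block dropped, so every later point exceeds `v`; after `m`
-- failures the kept points are small.
window : ∀ n m (f : Vec ℕ 1 → ℕ) X → Asc X → m * n ≤ length X →
  (∃[ X′ ] X′ ⊑ X × Asc X′ × length X′ ≡ n × Big f X′) ⊎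
  (∃[ X′ ] X′ ⊑ X × Asc X′ × length X′ ≡ m × Small f X′)
window n zero    f X asc p = inj₂ ([] , (λ ()) , [] , refl , λ _ _ ())
window n (suc m) f X asc p with split-asc n asc (≤-trans (m≤m+n n _) p)
... | B , R , ascB , ascR , subB , subR , lenB , lenR , B<R
  with All.all? (λ x → All.all? (λ v → x <? v →-dec v <? f (x ∷ [])) B) B
...   | yes all = inj₁ (B , subB , ascB , lenB ,
          λ { {x ∷ []} _ Q∈ v∈ v≫ → All.lookup (All.lookup all (Q∈ zero)) v∈ (v≫ zero) })
...   | no ¬all
  with find (All.¬All⇒Any¬ (λ x → All.all? (λ v → x <? v →-dec v <? f (x ∷ [])) B) B ¬all)
...     | x , x∈ , ¬all′ with find (All.¬All⇒Any¬ (λ v → x <? v →-dec v <? f (x ∷ [])) B ¬all′)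
...       | v , v∈ , ¬big
  with window n m f R ascR (+-cancelˡ-≤ n _ _ (≤-trans p (≤-reflexive (sym lenR))))
...         | inj₁ (X′ , sub , rest) = inj₁ (X′ , subR ∘ sub , rest)
...         | inj₂ (X′ , sub , asc′ , len , small) = inj₂
          (x ∷ X′ , (λ { (here refl) → subB x∈ ; (there i) → subR (sub i) }) ,
           All.tabulate (B<R x∈ ∘ sub) ∷ asc′ , cong suc len , small′)
  where
  fx≤v : f (x ∷ []) ≤ v
  fx≤v = ≮⇒≥ (λ q → ¬big (λ _ → q))
  small′ : Small f (x ∷ X′)
  small′ {y ∷ []} {u} d Q∈ u∈ u≫ with Q∈ zero | u∈
  ... | here refl | here refl = contradiction (u≫ zero) (<-irrefl refl)
  ... | here refl | there i   = ≤-trans fx≤v (<⇒≤ (B<R v∈ (sub i)))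
  ... | there i   | here refl = contradiction (u≫ zero) (<⇒≯ (B<R x∈ (sub i)))
  ... | there i   | there i′  = small {y ∷ []} {u} d (λ { zero → i }) i′ u≫

-- Each function squares the number of points required, `window` being used with both targets equal.
windows : ∀ (fs : List (Vec ℕ 1 → ℕ)) n X → Asc X → n ^ (2 ^ length fs) ≤ length X →
  ∃[ X′ ] X′ ⊑ X × Asc X′ × length X′ ≡ n × (∀ {f} → f ∈ fs → Uniform f X′)
windows []       n X asc p with split-asc n asc (≤-trans (≤-reflexive (sym (*-identityʳ n))) p)
... | B , _ , ascB , _ , subB , _ , lenB , _ = B , subB , ascB , lenB , λ ()
windows (f ∷ fs) n X asc p
  with windows fs (n * n) X asc (≤-trans (≤-reflexive
         (trans (cong (λ m → (n * m) ^ (2 ^ length fs)) (sym (*-identityʳ n))) (^-*-assoc n 2 (2 ^ length fs)))) p)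
... | X₁ , sub₁ , asc₁ , len₁ , u₁ with window n n f X₁ asc₁ (≤-reflexive (sym len₁))
...   | inj₁ (X′ , sub , asc′ , len , big)   = X′ , sub₁ ∘ sub , asc′ , len ,
          λ { (here refl) → inj₁ big ; (there i) → uniform-⊑ sub (u₁ i) }
...   | inj₂ (X′ , sub , asc′ , len , small) = X′ , sub₁ ∘ sub , asc′ , len ,
          λ { (here refl) → inj₂ small ; (there i) → uniform-⊑ sub (u₁ i) }

infix 4 _<[_]_
_<[_]_ : ℕ → Bool → ℕ → Set
x <[ true  ] y = x < y
x <[ false ] y = y < x

<[]-irrefl : ∀ s {x} → ¬ (x <[ s ] x)
<[]-irrefl true  = <-irrefl refl
<[]-irrefl false = <-irrefl refl

<[]-not : ∀ s {x y} → x <[ not s ] y → y <[ s ] x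
<[]-not true  p = p
<[]-not false p = p

<[]-cmp : ∀ s x y → x <[ s ] y ⊎ x ≡ y ⊎ y <[ s ] x
<[]-cmp s x y with <-cmp x y
<[]-cmp true  x y | tri< p _ _ = inj₁ p
<[]-cmp true  x y | tri≈ _ p _ = inj₂ (inj₁ p)
<[]-cmp true  x y | tri> _ _ p = inj₂ (inj₂ p)
<[]-cmp false x y | tri< p _ _ = inj₂ (inj₂ p)
<[]-cmp false x y | tri≈ _ p _ = inj₂ (inj₁ p)
<[]-cmp false x y | tri> _ _ p = inj₁ p

-- Lexicographic orderings

-- A canonical ordering compares tuples lexicographically along a list of
-- positions, each with a direction (true: increasing).
Code : ℕ → Set
Code k = List (Fin k × Bool)

Lex : ∀ {k} → Code k → Vec ℕ k → Vec ℕ k → Set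
Lex []            S T = ⊥
Lex ((p , s) ∷ c) S T = lookup S p <[ s ] lookup T p ⊎ lookup S p ≡ lookup T p × Lex c S T

Agree : ∀ {k} → Code k → Vec ℕ k → Vec ℕ k → Set
Agree c S T = ∀ {p s} → (p , s) ∈ c → lookup S p ≡ lookup T p

Complete Distinct : ∀ {k} → Code k → Set
Complete c = ∀ p → ∃[ s ] (p , s) ∈ c
Distinct c = AllPairs (λ a b → proj₁ a ≢ proj₁ b) c

lex-++ˡ : ∀ {k} (c₁ : Code k) {c₂ S T} → Lex c₁ S T → Lex (c₁ ++ c₂) S T
lex-++ˡ (_ ∷ c₁) (inj₁ p)       = inj₁ p
lex-++ˡ (_ ∷ c₁) (inj₂ (e , l)) = inj₂ (e , lex-++ˡ c₁ l)

lex-++ʳ : ∀ {k} (c₁ : Code k) {c₂ S T} → Agree c₁ S T → Lex c₂ S T → Lex (c₁ ++ c₂) S T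
lex-++ʳ []       ag l = l
lex-++ʳ (_ ∷ c₁) ag l = inj₂ (ag (here refl) , lex-++ʳ c₁ (ag ∘ there) l)

lex-++⁻ : ∀ {k} (c₁ : Code k) {c₂ S T} → Lex (c₁ ++ c₂) S T → Lex c₁ S T ⊎ Agree c₁ S T × Lex c₂ S T
lex-++⁻ []       l              = inj₂ ((λ ()) , l)
lex-++⁻ (_ ∷ c₁) (inj₁ p)       = inj₁ (inj₁ p)
lex-++⁻ (_ ∷ c₁) (inj₂ (e , l)) with lex-++⁻ c₁ l
... | inj₁ l′        = inj₁ (inj₂ (e , l′))
... | inj₂ (ag , l′) = inj₂ ((λ { (here refl) → e ; (there i) → ag i }) , l′)

lex-cmp : ∀ {k} (c : Code k) S T → Agree c S T ⊎ Lex c S T ⊎ Lex c T S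
lex-cmp []            S T = inj₁ λ ()
lex-cmp ((p , s) ∷ c) S T with <[]-cmp s (lookup S p) (lookup T p)
... | inj₁ l        = inj₂ (inj₁ (inj₁ l))
... | inj₂ (inj₂ l) = inj₂ (inj₂ (inj₁ l))
... | inj₂ (inj₁ e) with lex-cmp c S T
...   | inj₁ ag       = inj₁ λ { (here refl) → e ; (there i) → ag i }
...   | inj₂ (inj₁ l) = inj₂ (inj₁ (inj₂ (e , l)))
...   | inj₂ (inj₂ l) = inj₂ (inj₂ (inj₂ (sym e , l)))

agree-complete : ∀ {k} {c : Code k} {S T} → Complete c → Agree c S T → S ≡ T
agree-complete comp ag = lookup-ext λ i → ag (proj₂ (comp i))

reverse : ∀ {k} → Code k → Code k
reverse = map λ (p , s) → p , not s

lex-reverse : ∀ {k} (c : Code k) {S T} → Lex (reverse c) S T → Lex c T S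
lex-reverse ((p , s) ∷ c) (inj₁ l)       = inj₁ (<[]-not s l)
lex-reverse ((p , s) ∷ c) (inj₂ (e , l)) = inj₂ (sym e , lex-reverse c l)

complete-reverse : ∀ {k} {c : Code k} → Complete c → Complete (reverse c)
complete-reverse comp p = _ , ∈-map⁺ _ (proj₂ (comp p))

distinct-reverse : ∀ {k} {c : Code k} → Distinct c → Distinct (reverse c)
distinct-reverse d = AllPairs.map⁺ d

raise : ∀ {k} → Code k → Code (suc k)
raise = map λ (p , s) → suc p , s

lex-raise⁻ : ∀ {k} (c : Code k) {z z′ S T} → Lex (raise c) (z ∷ S) (z′ ∷ T) → Lex c S T
lex-raise⁻ ((p , s) ∷ c) (inj₁ l)       = inj₁ l
lex-raise⁻ ((p , s) ∷ c) (inj₂ (e , l)) = inj₂ (e , lex-raise⁻ c l)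

agree-raise⁻ : ∀ {k} (c : Code k) {z z′ S T} → Agree (raise c) (z ∷ S) (z′ ∷ T) → Agree c S T
agree-raise⁻ c ag i = ag (∈-map⁺ _ i)

insert : ∀ {k} → Code k → Code k → Bool → Code (suc k)
insert c₁ c₂ s = raise c₁ ++ (zero , s) ∷ raise c₂

complete-insert : ∀ {k} (c₁ c₂ : Code k) s → Complete (c₁ ++ c₂) → Complete (insert c₁ c₂ s)
complete-insert c₁ c₂ s comp zero    = s , ∈-++⁺ʳ (raise c₁) (here refl)
complete-insert c₁ c₂ s comp (suc p) with comp p
... | t , i with ∈-++⁻ c₁ i
...   | inj₁ j = t , ∈-++⁺ˡ (∈-map⁺ _ j)
...   | inj₂ j = t , ∈-++⁺ʳ (raise c₁) (there (∈-map⁺ _ j))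

distinct-insert : ∀ {k} (c₁ c₂ : Code k) s → Distinct (c₁ ++ c₂) → Distinct (insert c₁ c₂ s)
distinct-insert []             c₂ s d       =
  All.tabulate (λ i → fresh (∈-map⁻ _ i)) ∷ AllPairs.map⁺ (AllPairs.map (λ ne → ne ∘ λ { refl → refl }) d)
  where
  fresh : ∀ {y} → ∃[ x ] x ∈ c₂ × y ≡ (suc (proj₁ x) , proj₂ x) → zero ≢ proj₁ y
  fresh (_ , _ , refl) ()
distinct-insert ((p , t) ∷ c₁) c₂ s (a ∷ d) = All.tabulate go ∷ distinct-insert c₁ c₂ s d
  where
  go : ∀ {y} → y ∈ insert c₁ c₂ s → suc p ≢ proj₁ y
  go i with ∈-++⁻ (raise c₁) i
  ... | inj₂ (here refl) = λ ()
  ... | inj₁ j with ∈-map⁻ _ j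
  ...   | _ , k , refl = λ { refl → All.lookup a (∈-++⁺ˡ k) refl }
  go i | inj₂ (there j) with ∈-map⁻ _ j
  ...   | _ , k , refl = λ { refl → All.lookup a (∈-++⁺ʳ c₁ k) refl }

distinct-++ : ∀ {k} (c₁ : Code k) {c₂ p s t} → Distinct (c₁ ++ c₂) → (p , s) ∈ c₁ → (p , t) ∉ c₂
distinct-++ (_ ∷ c₁) (a ∷ d) (here refl) j = All.lookup a (∈-++⁺ʳ c₁ j) refl
distinct-++ (_ ∷ c₁) (a ∷ d) (there i)   j = distinct-++ c₁ d i j

-- Gives conditions the shape that `Uniform` handles: if `P` is closed downwards on the list, it
-- holds at a point exactly when the point is below this number. The value 0, for lists without
-- witness, has no point below it.
threshold : ∀ {P : ℕ → Set} → (∀ z → Dec (P z)) → List ℕ → ℕ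
threshold P? []       = 0
threshold P? (y ∷ ys) with P? y
... | yes _ = suc y ⊔ threshold P? ys
... | no  _ = threshold P? ys

<-threshold : ∀ {P : ℕ → Set} (P? : ∀ z → Dec (P z)) {Y z} → z ∈ Y → P z → z < threshold P? Y
<-threshold P? {y ∷ Y} (here refl) pz with P? y
... | yes _ = m≤m⊔n (suc y) (threshold P? Y)
... | no ¬p = contradiction pz ¬p
<-threshold P? {y ∷ Y} (there i) pz with P? y
... | yes _ = ≤-trans (<-threshold P? i pz) (m≤n⊔m (suc y) _)
... | no  _ = <-threshold P? i pz

threshold-witness : ∀ {P : ℕ → Set} (P? : ∀ z → Dec (P z)) {Y z} → z < threshold P? Y →
                    ∃[ v ] v ∈ Y × P v × z ≤ v
threshold-witness P? {y ∷ Y} {z} p with P? y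
... | no  _ with threshold-witness P? {Y} p
...   | v , v∈ , pv , z≤v = v , there v∈ , pv , z≤v
threshold-witness P? {y ∷ Y} {z} p | yes py with ⊔-sel (suc y) (threshold P? Y)
...   | inj₁ e = y , here refl , py , s≤s⁻¹ (subst (z <_) e p)
...   | inj₂ e with threshold-witness P? {Y} (subst (z <_) e p)
...     | v , v∈ , pv , z≤v = v , there v∈ , pv , z≤v

-- No point of `X` lies between `x°` and `x`. Replacing `x` by `x°` in a tuple over `X` is therefore
-- strict at that position and keeps the order relative to the other entries.
Notched : List ℕ → List ℕ → Set
Notched X X₀ = ∀ s {x} → x ∈ X → ∃[ x° ] x° ∈ X₀ × x° <[ s ] x × (∀ {y} → y ∈ X → y <[ s ] x → y <[ s ] x°)

-- Every second point is kept and the dropped ones are the notches; the additional `a` is the notch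
-- below the least kept point.
thin : ∀ m a Z → Asc (a ∷ Z) → m * 2 ≤ length Z →
       ∃[ X ] X ⊑ Z × Asc X × length X ≡ m × Notched X (a ∷ Z)
thin zero    a Z asc p = [] , (λ ()) , [] , refl , λ s ()
thin (suc m) a (x ∷ a′ ∷ Z) ((a<x ∷ _) ∷ x< ∷ asc) (s≤s (s≤s p)) with thin m a′ Z asc p
... | X , sub , ascX , len , notched =
  x ∷ X , (λ { (here e) → here e ; (there i) → there (there (sub i)) }) ,
  All.tabulate (λ i → All.lookup x< (there (sub i))) ∷ ascX , cong suc len , notched′
  where
  x<X : ∀ {y} → y ∈ X → x < y
  x<X i = All.lookup x< (there (sub i))
  notched′ : Notched (x ∷ X) (a ∷ x ∷ a′ ∷ Z)
  notched′ true  (here refl) = a , here refl , a<x ,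
    λ { (here refl) q → contradiction q (<-irrefl refl) ; (there i) q → contradiction q (<⇒≯ (x<X i)) }
  notched′ false (here refl) = a′ , there (there (here refl)) , All.lookup x< (here refl) ,
    λ { (here refl) q → contradiction q (<-irrefl refl) ; (there i) q → All.lookup (AllPairs.head asc) (sub i) }
  notched′ true  (there j) with notched true j
  ... | x° , i , q , h = x° , there (there i) , q ,
    λ { (here refl) _ → All.lookup x< i ; (there l) r → h l r }
  notched′ false (there j) with notched false j
  ... | x° , i , q , h = x° , there (there i) , q ,
    λ { (here refl) r → contradiction r (<⇒≯ (x<X j)) ; (there l) r → h l r }

-- Inserting the last coordinate

-- A pair of tuples differing only at position `p` is coded as one (k+1)-tuple that has both values
-- of position `p` as neighbouring entries. A condition on such pairs thus becomes a function of k+1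
-- variables.
pick : ∀ {k} → Bool → Fin k → Vec ℕ (suc k) → Vec ℕ k
pick true  zero    (a ∷ b ∷ Q) = a ∷ Q
pick false zero    (a ∷ b ∷ Q) = b ∷ Q
pick s     (suc p) (a ∷ Q)     = a ∷ pick s p Q

-- Applies also to `A` and `B` that differ elsewhere: the splice decreases as soon as the two
-- entries meeting at `p` do. This is what lets `yields-less` cross between such tuples.
merge : ∀ {k} → Fin k → Vec ℕ k → Vec ℕ k → Vec ℕ (suc k)
merge zero    (a ∷ A) B       = a ∷ B
merge (suc p) (a ∷ A) (b ∷ B) = a ∷ merge p A B

≫-merge : ∀ {k z} (p : Fin k) {A B} → Desc B → z ≫ A → lookup B p < lookup A p → z ≫ merge p A B
≫-merge zero    {a ∷ A} {b ∷ B} d h l zero          = h zero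
≫-merge zero    {a ∷ A} {b ∷ B} d h l (suc zero)    = <-trans l (h zero)
≫-merge zero    {a ∷ A} {b ∷ B} d h l (suc (suc i)) = <-trans (desc-head d i) (<-trans l (h zero))
≫-merge (suc p) {a ∷ A} {b ∷ B} d h l zero          = h zero
≫-merge (suc p) {a ∷ A} {b ∷ B} d h l (suc i)       = ≫-merge p (desc-tail d) (h ∘ suc) l i

desc-merge : ∀ {k} (p : Fin k) {A B} → Desc A → Desc B → lookup B p < lookup A p → Desc (merge p A B)
desc-merge zero    {a ∷ A} {b ∷ B} dA dB l = desc-∷ (λ { zero → l ; (suc i) → <-trans (desc-head dB i) l }) dB
desc-merge (suc p) {a ∷ A} {b ∷ B} dA dB l =
  desc-∷ (≫-merge p (desc-tail dB) (desc-head dA) l) (desc-merge p (desc-tail dA) (desc-tail dB) l)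

⊏-merge : ∀ {k X} (p : Fin k) {A B} → A ⊏ X → B ⊏ X → merge p A B ⊏ X
⊏-merge zero    {a ∷ A} {b ∷ B} iA iB zero    = iA zero
⊏-merge zero    {a ∷ A} {b ∷ B} iA iB (suc i) = iB i
⊏-merge (suc p) {a ∷ A} {b ∷ B} iA iB zero    = iA zero
⊏-merge (suc p) {a ∷ A} {b ∷ B} iA iB (suc i) = ⊏-merge p (iA ∘ suc) (iB ∘ suc) i

⊏-pick : ∀ {k X} s (p : Fin k) {Q} → Q ⊏ X → pick s p Q ⊏ X
⊏-pick true  zero    {a ∷ b ∷ Q} h zero    = h zero
⊏-pick true  zero    {a ∷ b ∷ Q} h (suc i) = h (suc (suc i))
⊏-pick false zero    {a ∷ b ∷ Q} h i       = h (suc i)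
⊏-pick true  (suc p) {a ∷ Q}     h zero    = h zero
⊏-pick true  (suc p) {a ∷ Q}     h (suc i) = ⊏-pick true p (h ∘ suc) i
⊏-pick false (suc p) {a ∷ Q}     h zero    = h zero
⊏-pick false (suc p) {a ∷ Q}     h (suc i) = ⊏-pick false p (h ∘ suc) i

≫-pick : ∀ {k z} s (p : Fin k) {Q} → z ≫ Q → z ≫ pick s p Q
≫-pick true  zero    {a ∷ b ∷ Q} h zero    = h zero
≫-pick true  zero    {a ∷ b ∷ Q} h (suc i) = h (suc (suc i))
≫-pick false zero    {a ∷ b ∷ Q} h i       = h (suc i)
≫-pick true  (suc p) {a ∷ Q}     h zero    = h zero
≫-pick true  (suc p) {a ∷ Q}     h (suc i) = ≫-pick true p (h ∘ suc) i
≫-pick false (suc p) {a ∷ Q}     h zero    = h zero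
≫-pick false (suc p) {a ∷ Q}     h (suc i) = ≫-pick false p (h ∘ suc) i

desc-pick : ∀ {k} s (p : Fin k) {Q} → Desc Q → Desc (pick s p Q)
desc-pick true  zero    {a ∷ b ∷ Q} d = desc-∷ (desc-head d ∘ suc) (desc-tail (desc-tail d))
desc-pick false zero    {a ∷ b ∷ Q} d = desc-tail d
desc-pick true  (suc p) {a ∷ Q}     d = desc-∷ (≫-pick true p (desc-head d)) (desc-pick true p (desc-tail d))
desc-pick false (suc p) {a ∷ Q}     d = desc-∷ (≫-pick false p (desc-head d)) (desc-pick false p (desc-tail d))

lookup-pick-merge : ∀ {k} t (p : Fin k) {A B q} → lookup A q ≡ lookup B q → lookup (pick t p (merge p A B)) q ≡ lookup B q
lookup-pick-merge true  zero    {a ∷ A} {b ∷ B} {zero}  e = e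
lookup-pick-merge true  zero    {a ∷ A} {b ∷ B} {suc q} e = refl
lookup-pick-merge false zero    {a ∷ A} {b ∷ B} {q}     e = refl
lookup-pick-merge true  (suc p) {a ∷ A} {b ∷ B} {zero}  e = e
lookup-pick-merge true  (suc p) {a ∷ A} {b ∷ B} {suc q} e = lookup-pick-merge true p e
lookup-pick-merge false (suc p) {a ∷ A} {b ∷ B} {zero}  e = e
lookup-pick-merge false (suc p) {a ∷ A} {b ∷ B} {suc q} e = lookup-pick-merge false p e

lookup-pick-true : ∀ {k} (p : Fin k) A B → lookup (pick true p (merge p A B)) p ≡ lookup A p
lookup-pick-true zero    (a ∷ A) (b ∷ B) = refl
lookup-pick-true (suc p) (a ∷ A) (b ∷ B) = lookup-pick-true p A B

lookup-pick-false : ∀ {k} (p : Fin k) A B → lookup (pick false p (merge p A B)) p ≡ lookup B p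
lookup-pick-false zero    (a ∷ A) (b ∷ B) = refl
lookup-pick-false (suc p) (a ∷ A) (b ∷ B) = lookup-pick-false p A B

-- For Q = join s p S T the tuples pick s p Q and pick (not s) p Q differ
-- only at position p, where they take the values of S and of T.
join : ∀ {k} → Bool → Fin k → Vec ℕ k → Vec ℕ k → Vec ℕ (suc k)
join true  p S T = merge p S T
join false p S T = merge p T S

desc-join : ∀ {k} s (p : Fin k) {S T} → Desc S → Desc T → lookup T p <[ s ] lookup S p → Desc (join s p S T)
desc-join true  p dS dT l = desc-merge p dS dT l
desc-join false p dS dT l = desc-merge p dT dS l

⊏-join : ∀ {k X} s (p : Fin k) {S T} → S ⊏ X → T ⊏ X → join s p S T ⊏ X
⊏-join true  p iS iT = ⊏-merge p iS iT
⊏-join false p iS iT = ⊏-merge p iT iS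

≫-join : ∀ {k z} s (p : Fin k) {S T} → Desc S → Desc T → z ≫ S → z ≫ T →
         lookup T p <[ s ] lookup S p → z ≫ join s p S T
≫-join true  p dS dT hS hT l = ≫-merge p dT hS l
≫-join false p dS dT hS hT l = ≫-merge p dS hT l

lookup-join : ∀ {k} s (p : Fin k) {S T} t {q} → lookup S q ≡ lookup T q →
              lookup (pick t p (join s p S T)) q ≡ lookup T q
lookup-join true  p t e = lookup-pick-merge t p e
lookup-join false p t e = trans (lookup-pick-merge t p (sym e)) e

lookup-join-S : ∀ {k} s (p : Fin k) S T → lookup (pick s p (join s p S T)) p ≡ lookup S p
lookup-join-S true  p S T = lookup-pick-true p S T
lookup-join-S false p S T = lookup-pick-false p T S

lookup-join-T : ∀ {k} s (p : Fin k) S T → lookup (pick (not s) p (join s p S T)) p ≡ lookup T p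
lookup-join-T true  p S T = lookup-pick-false p S T
lookup-join-T false p S T = lookup-pick-true p T S

module _ {k : ℕ} (s : Bool) (p : Fin k) (S T : Vec ℕ k)
  (off : ∀ q → q ≢ p → lookup S q ≡ lookup T q) where

  pick-S : pick s p (join s p S T) ≡ S
  pick-S = lookup-ext go
    where
    go : ∀ q → lookup (pick s p (join s p S T)) q ≡ lookup S q
    go q with q Fin.≟ p
    ... | yes refl = lookup-join-S s p S T
    ... | no  q≢p  = trans (lookup-join s p s (off q q≢p)) (sym (off q q≢p))

  pick-T : pick (not s) p (join s p S T) ≡ T
  pick-T = lookup-ext go
    where
    go : ∀ q → lookup (pick (not s) p (join s p S T)) q ≡ lookup T q
    go q with q Fin.≟ p
    ... | yes refl = lookup-join-T s p S T
    ... | no  q≢p  = lookup-join s p (not s) (off q q≢p)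

notch-below : ∀ s {x° x y} → x° <[ s ] x → (y <[ s ] x → y <[ s ] x°) → x < y → x° < y
notch-below true  x°<x h x<y = <-trans x°<x x<y
notch-below false x°<x h x<y = h x<y

notch-above : ∀ s {x° x y} → x° <[ s ] x → (y <[ s ] x → y <[ s ] x°) → y < x → y < x°
notch-above true  x°<x h y<x = h y<x
notch-above false x°<x h y<x = <-trans y<x x°<x

lex-split : ∀ {k} (c : Code k) {S T} → Lex c S T →
  ∃[ c₀ ] ∃[ p ] ∃[ s ] ∃[ c₃ ] c ≡ c₀ ++ (p , s) ∷ c₃ × Agree c₀ S T × lookup S p <[ s ] lookup T p
lex-split ((p , s) ∷ c) (inj₁ l)       = [] , p , s , c , refl , (λ ()) , l
lex-split ((p , s) ∷ c) (inj₂ (e , l)) with lex-split c l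
... | c₀ , q , t , c₃ , refl , ag , l′ =
  (p , s) ∷ c₀ , q , t , c₃ , refl , (λ { (here refl) → e ; (there i) → ag i }) , l′

module Notch {k : ℕ} {X X₀ : List ℕ} (notched : Notched X X₀) (X⊑X₀ : X ⊑ X₀)
  (s : Bool) (p : Fin k) (S : Vec ℕ k) (dS : Desc S) (iS : S ⊏ X) where

  private
    n = notched s (iS p)

  value : ℕ
  value = proj₁ n

  value< : value <[ s ] lookup S p
  value< = proj₁ (proj₂ (proj₂ n))

  between : ∀ {y} → y ∈ X → y <[ s ] lookup S p → y <[ s ] value
  between = proj₂ (proj₂ (proj₂ n))

  moved : Vec ℕ k
  moved = S [ p ]≔ value

  at : lookup moved p ≡ value
  at = Vec.lookup∘update p S value

  off : ∀ q → q ≢ p → lookup moved q ≡ lookup S q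
  off q q≢p = Vec.lookup∘update′ q≢p S value

  value-< : ∀ {y} → y ∈ X → lookup S p < y → value < y
  value-< y∈ = notch-below s value< (between y∈)

  <-value : ∀ {y} → y ∈ X → y < lookup S p → y < value
  <-value y∈ = notch-above s value< (between y∈)

  ⊏-moved : moved ⊏ X₀
  ⊏-moved i with i Fin.≟ p
  ... | yes refl = subst (_∈ X₀) (sym at) (proj₁ (proj₂ n))
  ... | no  i≢p  = subst (_∈ X₀) (sym (off i i≢p)) (X⊑X₀ (iS i))

  ≫-moved : ∀ {z} → z ∈ X → z ≫ S → z ≫ moved
  ≫-moved z∈ h i with i Fin.≟ p
  ... | yes refl = subst (_< _) (sym at) (value-< z∈ (h p))
  ... | no  i≢p  = subst (_< _) (sym (off i i≢p)) (h i)

  desc-moved : Desc moved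
  desc-moved {i} {j} l with i Fin.≟ p | j Fin.≟ p
  ... | yes refl | yes refl = contradiction l (<-irrefl refl)
  ... | yes refl | no  j≢p  = subst₂ _<_ (sym (off j j≢p)) (sym at) (<-value (iS j) (dS l))
  ... | no  i≢p  | yes refl = subst₂ _<_ (sym at) (sym (off i i≢p)) (value-< (iS i) (dS l))
  ... | no  i≢p  | no  j≢p  = subst₂ _<_ (sym (off j j≢p)) (sym (off i i≢p)) (dS l)

  Q : Vec ℕ (suc k)
  Q = join s p S moved

  off′ : ∀ q → q ≢ p → lookup S q ≡ lookup moved q
  off′ q q≢p = sym (off q q≢p)

  moved<S : lookup moved p <[ s ] lookup S p
  moved<S = subst (_<[ s ] lookup S p) (sym at) value<

  desc-Q : Desc Q
  desc-Q = desc-join s p dS desc-moved moved<S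

  ⊏-Q : Q ⊏ X₀
  ⊏-Q = ⊏-join s p (X⊑X₀ ∘ iS) ⊏-moved

  ≫-Q : ∀ {z} → z ∈ X → z ≫ S → z ≫ Q
  ≫-Q z∈ h = ≫-join s p dS desc-moved h (≫-moved z∈ h) moved<S

module Insertion {k : ℕ} {V : Set} (_≺_ : V → V → Set) (≺-trans : ∀ {x y z} → x ≺ y → y ≺ z → x ≺ z)
  (F : Vec ℕ (suc k) → V) (G : Vec ℕ k → V) (X₀ : List ℕ) where

  record Ok {l : ℕ} (S : Vec ℕ l) : Set where
    constructor mkOk
    field
      is-desc : Desc S
      is-in   : S ⊏ X₀

  -- When tuples differ only at position p, the last coordinate outweighs
  -- position p (Yields) or is outweighed by it (Dominates).
  Yields Dominates : Fin k × Bool → Set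
  Yields    (p , s) = ∀ {Q z} → Ok Q → z ∈ X₀ → z ≫ Q → F (z ∷ pick s p Q) ≺ G (pick (not s) p Q)
  Dominates (p , s) = ∀ {Q z} → Ok Q → z ∈ X₀ → z ≫ Q → G (pick (not s) p Q) ≺ F (z ∷ pick s p Q)

  HeadYields : Code k → Set
  HeadYields []      = ⊤
  HeadYields (x ∷ _) = Yields x

  cut : ∀ (c : Code k) → (∀ {x} → x ∈ c → Yields x ⊎ Dominates x) →
        ∃[ c₁ ] ∃[ c₂ ] c ≡ c₁ ++ c₂ × (∀ {x} → x ∈ c₁ → Dominates x) × HeadYields c₂
  cut []      h = [] , [] , refl , (λ ()) , tt
  cut (x ∷ c) h with h (here refl)
  ... | inj₁ y = [] , x ∷ c , refl , (λ ()) , y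
  ... | inj₂ n with cut c (h ∘ there)
  ...   | c₁ , c₂ , refl , dom , yld = x ∷ c₁ , c₂ , refl , (λ { (here refl) → n ; (there i) → dom i }) , yld

  module _
    (increasing : ∀ {z S} → Ok S → z ∈ X₀ → z ≫ S → F (z ∷ S) ≺ G S)
    (below-limit : ∀ {z S T} → Ok S → Ok T → z ∈ X₀ → z ≫ S → z ≫ T → F T ≺ G S → F T ≺ F (z ∷ S))
    (above-limit : ∀ {z S T} → Ok S → Ok T → z ∈ X₀ → z ≫ S → z ≫ T → G S ≺ F T → F (z ∷ S) ≺ F T)
    (same-last : ∀ {z S T} → Ok S → Ok T → z ∈ X₀ → z ≫ S → z ≫ T → G S ≺ G T → F (z ∷ S) ≺ F (z ∷ T))
    (c₁ c₂ : Code k)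
    (lexG : ∀ {S T} → Ok S → Ok T → Lex (c₁ ++ c₂) S T → G S ≺ G T)
    (complete : Complete (c₁ ++ c₂)) (distinct : Distinct (c₁ ++ c₂))
    (dominates : ∀ {x} → x ∈ c₁ → Dominates x) (yields : HeadYields c₂)
    (X : List ℕ) (X⊑X₀ : X ⊑ X₀) (notched : Notched X X₀) where

    ok : ∀ {l} {S : Vec ℕ l} → Desc S → S ⊏ X → Ok S
    ok d i = mkOk d (X⊑X₀ ∘ i)

    -- `Dominates` treats one position, but `S` and `T` may also differ after `p`. With entry `p` of
    -- `T` moved to its notch the tuple still follows `S` lexicographically, and only position `p`
    -- separates it from `T`.
    dominated : ∀ {z} S T → Desc S → S ⊏ X → Desc T → T ⊏ X → z ∈ X → z ≫ T →
                Lex c₁ S T → G S ≺ F (z ∷ T)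
    dominated {z} S T dS iS dT iT z∈ z≫ l with lex-split c₁ l
    ... | c₀ , p , s , c₃ , refl , ag , S<T = ≺-trans
      (lexG (ok {S = S} dS iS) (mkOk {S = moved} desc-moved ⊏-moved)
        (lex-++ˡ (c₀ ++ (p , s) ∷ c₃) (lex-++ʳ c₀ ag′ (inj₁ (subst (lookup S p <[ s ]_) (sym at) (between (iS p) S<T))))))
      (subst₂ (λ A B → G A ≺ F (z ∷ B)) (pick-T s p T moved off′) (pick-S s p T moved off′)
        (dominates (∈-++⁺ʳ c₀ (here refl)) (mkOk {S = Q} desc-Q ⊏-Q) (X⊑X₀ z∈) (≫-Q z∈ z≫)))
      where
      open Notch notched X⊑X₀ s p T dT iT
      ag′ : Agree c₀ S moved
      ag′ {q} i with q Fin.≟ p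
      ... | yes refl = contradiction (subst (lookup S p <[ s ]_) (sym (ag i)) S<T) (<[]-irrefl s)
      ... | no  q≢p  = trans (ag i) (off′ q q≢p)

    module _ {p s c₃} (c₂≡ : c₂ ≡ (p , s) ∷ c₃) where

      yields-p : Yields (p , s)
      yields-p = subst HeadYields c₂≡ yields

      fresh : ∀ {q t} → (q , t) ∈ c₁ → q ≢ p
      fresh i refl = distinct-++ c₁ {s = _} {t = s} distinct i (subst ((p , s) ∈_) (sym c₂≡) (here refl))

      lexG′ : ∀ {S T} → Ok S → Ok T → Agree c₁ S T → lookup S p <[ s ] lookup T p → G S ≺ G T
      lexG′ okS okT ag l = lexG okS okT (lex-++ʳ c₁ ag (subst (λ c → Lex c _ _) (sym c₂≡) (inj₁ l)))

      -- Moving entry `p` of `S` to its notch puts the tuple before `T` whatever the positions after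
      -- `p` say, and yielding places `F (z ∷ S)` below the limit value of even that tuple.
      yields-equal : ∀ {z} S T → Desc S → S ⊏ X → Desc T → T ⊏ X → z ∈ X → z ≫ S →
                     Agree c₁ S T → lookup S p ≡ lookup T p → F (z ∷ S) ≺ G T
      yields-equal {z} S T dS iS dT iT z∈ z≫ ag e = ≺-trans
        (subst₂ (λ A B → F (z ∷ A) ≺ G B) (pick-S s p S moved off′) (pick-T s p S moved off′)
          (yields-p (mkOk {S = Q} desc-Q ⊏-Q) (X⊑X₀ z∈) (≫-Q z∈ z≫)))
        (lexG′ (mkOk {S = moved} desc-moved ⊏-moved) (ok {S = T} dT iT)
          (λ {q} i → trans (off q (fresh i)) (ag i)) (subst (lookup moved p <[ s ]_) e moved<S))
        where open Notch notched X⊑X₀ s p S dS iS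

      -- The chain S → pick s p Q → pick (not s) p Q → T keeps all values in X
      -- and uses a fresh larger last coordinate at every step.
      yields-less : ∀ {z τ₁ τ₂} S T → Desc S → S ⊏ X → Desc T → T ⊏ X → z ∈ X → z ≫ S →
                    τ₁ ∈ X → τ₂ ∈ X → z < τ₁ → τ₁ ≫ T → τ₁ < τ₂ →
                    Agree c₁ S T → lookup T p <[ s ] lookup S p → F (z ∷ S) ≺ G T
      yields-less {z} {τ₁} {τ₂} S T dS iS dT iT z∈ z≫ τ₁∈ τ₂∈ z<τ₁ τ₁≫T τ₁<τ₂ ag l =
        ≺-trans (below-limit okA (ok {S = z ∷ S} (desc-∷ z≫ dS) (⊏-∷ z∈ iS)) (X⊑X₀ τ₁∈) τ₁≫A (≫-∷ z<τ₁ τ₁≫S)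
                  (yields-equal S A dS iS dA iA z∈ z≫
                    (λ {q} i → trans (ag i) (sym (lookup-join s p s (ag i)))) (sym (lookup-join-S s p S T))))
        (≺-trans (below-limit okB (ok {S = τ₁ ∷ A} (desc-∷ τ₁≫A dA) (⊏-∷ τ₁∈ iA)) (X⊑X₀ τ₂∈) τ₂≫B
                   (≫-∷ τ₁<τ₂ (λ i → <-trans (τ₁≫A i) τ₁<τ₂))
                   (yields-p (mkOk {S = Q} dQ (X⊑X₀ ∘ iQ)) (X⊑X₀ τ₁∈) τ₁≫Q))
        (yields-equal B T dB iB dT iT τ₂∈ τ₂≫B (λ i → lookup-join s p (not s) (ag i)) (lookup-join-T s p S T)))
        where
        Q = join s p S T
        τ₁≫S : τ₁ ≫ S
        τ₁≫S i = <-trans (z≫ i) z<τ₁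
        dQ : Desc Q
        dQ = desc-join s p dS dT l
        iQ = ⊏-join s p iS iT
        τ₁≫Q = ≫-join s p dS dT τ₁≫S τ₁≫T l
        A = pick s p Q
        B = pick (not s) p Q
        dA : Desc A
        dA = desc-pick s p dQ
        iA = ⊏-pick s p iQ
        okA : Ok A
        okA = ok dA iA
        τ₁≫A = ≫-pick s p τ₁≫Q
        dB : Desc B
        dB = desc-pick (not s) p dQ
        iB = ⊏-pick (not s) p iQ
        okB : Ok B
        okB = ok dB iB
        τ₂≫B : τ₂ ≫ B
        τ₂≫B i = <-trans (≫-pick (not s) p τ₁≫Q i) τ₁<τ₂

    yielded : ∀ {z τ₁ τ₂} S T → Desc S → S ⊏ X → Desc T → T ⊏ X → z ∈ X → z ≫ S →
              τ₁ ∈ X → τ₂ ∈ X → z < τ₁ → τ₁ ≫ T → τ₁ < τ₂ →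
              Agree c₁ S T → Lex c₂ T S → F (z ∷ S) ≺ G T
    yielded S T dS iS dT iT z∈ z≫ τ₁∈ τ₂∈ z<τ₁ τ₁≫T τ₁<τ₂ ag l = go c₂ refl l
      where
      go : ∀ c → c₂ ≡ c → Lex c _ _ → F _ ≺ G _
      go ((p , s) ∷ c) e (inj₁ l)       = yields-less e S T dS iS dT iT z∈ z≫ τ₁∈ τ₂∈ z<τ₁ τ₁≫T τ₁<τ₂ ag l
      go ((p , s) ∷ c) e (inj₂ (e′ , _)) = yields-equal e S T dS iS dT iT z∈ z≫ ag (sym e′)

    -- Towards tuples below its last coordinate a tuple behaves like its limit. Unequal last
    -- coordinates are therefore compared with the larger one sent to infinity: `F (z ∷ S)` against
    -- `G T`, or `G S` against `F (z′ ∷ T)`.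
    lexF : ∀ {τ₁ τ₂ S T} → τ₁ ∈ X → τ₂ ∈ X → τ₁ < τ₂ → Desc S → S ⊏ X → Desc T → T ⊏ X →
           τ₁ ≫ S → τ₁ ≫ T → Lex (insert c₁ c₂ true) S T → F S ≺ F T
    lexF {τ₁} {τ₂} {z ∷ S} {z′ ∷ T} τ₁∈ τ₂∈ τ₁<τ₂ dS iS dT iT τ₁≫S τ₁≫T l = go (lex-++⁻ (raise c₁) l)
      where
      dS₀ : Desc S
      dS₀ = desc-tail dS
      dT₀ : Desc T
      dT₀ = desc-tail dT
      iS₀ = iS ∘ suc
      iT₀ = iT ∘ suc
      z∈ = iS zero
      z′∈ = iT zero
      z≫ = desc-head dS
      z′≫ = desc-head dT
      okS : Ok S
      okS = ok dS₀ iS₀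
      okT : Ok T
      okT = ok dT₀ iT₀
      okzS : Ok (z ∷ S)
      okzS = ok dS iS
      okzT : Ok (z′ ∷ T)
      okzT = ok dT iT
      up : z < z′ → F (z ∷ S) ≺ G T → F (z ∷ S) ≺ F (z′ ∷ T)
      up z<z′ = below-limit okT okzS (X⊑X₀ z′∈) z′≫ (≫-∷ z<z′ (λ i → <-trans (z≫ i) z<z′))
      go : Lex (raise c₁) (z ∷ S) (z′ ∷ T) ⊎ Agree (raise c₁) (z ∷ S) (z′ ∷ T) × Lex ((zero , true) ∷ raise c₂) (z ∷ S) (z′ ∷ T) →
           F (z ∷ S) ≺ F (z′ ∷ T)
      go (inj₁ l) with lex-raise⁻ c₁ l | <-cmp z z′
      ... | l′ | tri< z<z′ _ _ = up z<z′ (≺-trans (increasing okS (X⊑X₀ z∈) z≫) (lexG okS okT (lex-++ˡ c₁ l′)))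
      ... | l′ | tri≈ _ refl _ = same-last okS okT (X⊑X₀ z∈) z≫ z′≫ (lexG okS okT (lex-++ˡ c₁ l′))
      ... | l′ | tri> _ _ z′<z = above-limit okS okzT (X⊑X₀ z∈) z≫ (≫-∷ z′<z (λ i → <-trans (z′≫ i) z′<z))
                                   (dominated S T dS₀ iS₀ dT₀ iT₀ z′∈ z′≫ l′)
      go (inj₂ (ag , inj₂ (refl , l))) = same-last okS okT (X⊑X₀ z∈) z≫ z′≫
        (lexG okS okT (lex-++ʳ c₁ (agree-raise⁻ c₁ ag) (lex-raise⁻ c₂ l)))
      go (inj₂ (ag , inj₁ z<z′)) = up z<z′ (cmp (lex-cmp c₂ S T))
        where
        ag′ : Agree c₁ S T
        ag′ = agree-raise⁻ c₁ ag
        cmp : Agree c₂ S T ⊎ Lex c₂ S T ⊎ Lex c₂ T S → F (z ∷ S) ≺ G T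
        cmp (inj₁ ag₂) = subst (λ U → F (z ∷ S) ≺ G U)
          (agree-complete complete (λ i → [ ag′ , ag₂ ]′ (∈-++⁻ c₁ i))) (increasing okS (X⊑X₀ z∈) z≫)
        cmp (inj₂ (inj₁ l)) = ≺-trans (increasing okS (X⊑X₀ z∈) z≫) (lexG okS okT (lex-++ʳ c₁ ag′ l))
        cmp (inj₂ (inj₂ l)) = yielded S T dS₀ iS₀ dT₀ iT₀ z∈ z≫ τ₁∈ τ₂∈ (τ₁≫S zero) (τ₁≫T ∘ suc) τ₁<τ₂ ag′ l

-- Positions of arbitrary numbers relative to Z; unlike the numbers
-- themselves they are bounded by the length of Z.
rank : List ℕ → ℕ → ℕ
rank []      x = 0
rank (z ∷ Z) x with z <? x
... | yes _ = suc (rank Z x)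
... | no  _ = rank Z x

rank≤ : ∀ Z x → rank Z x ≤ length Z
rank≤ []      x = z≤n
rank≤ (z ∷ Z) x with z <? x
... | yes _ = s≤s (rank≤ Z x)
... | no  _ = m≤n⇒m≤1+n (rank≤ Z x)

rank-mono : ∀ Z {x y} → x ≤ y → rank Z x ≤ rank Z y
rank-mono []      x≤y = z≤n
rank-mono (z ∷ Z) {x} {y} x≤y with z <? x | z <? y
... | yes _   | yes _  = s≤s (rank-mono Z x≤y)
... | yes z<x | no z≮y = contradiction (<-≤-trans z<x x≤y) z≮y
... | no  _   | yes _  = m≤n⇒m≤1+n (rank-mono Z x≤y)
... | no  _   | no  _  = rank-mono Z x≤y

rank-< : ∀ {Z x y} → x ∈ Z → x < y → rank Z x < rank Z y
rank-< {z ∷ Z} {x} {y} (here refl) x<y with z <? z | z <? y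
... | yes p | _     = contradiction p (<-irrefl refl)
... | no  _ | no p  = contradiction x<y p
... | no  _ | yes _ = s≤s (rank-mono Z (<⇒≤ x<y))
rank-< {z ∷ Z} {x} {y} (there i) x<y with z <? x | z <? y
... | yes _   | yes _  = s≤s (rank-< i x<y)
... | yes z<x | no z≮y = contradiction (<-trans z<x x<y) z≮y
... | no  _   | yes _  = m≤n⇒m≤1+n (rank-< i x<y)
... | no  _   | no  _  = rank-< i x<y

rank-cancel-< : ∀ Z {x y} → rank Z x < rank Z y → x < y
rank-cancel-< Z {x} {y} p with x <? y
... | yes q = q
... | no ¬q = contradiction p (≤⇒≯ (rank-mono Z (≮⇒≥ ¬q)))

module Scales (L : ℕ) (Z : List ℕ) (|Z|<2^L : length Z < 2 ^ L) where

  dist : ℕ → ℕ → ℕ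
  dist x y = sep L (rank Z x) (rank Z y)

  bound : ∀ x → rank Z x < 2 ^ L
  bound x = ≤-<-trans (rank≤ Z x) |Z|<2^L

  -- The scale of the jump from z up to e, or 0 if e ≤ z.
  jump : ℕ → ℕ → ℕ
  jump z e with z <? e
  ... | yes _ = dist z e
  ... | no  _ = 0

  jump≤ : ∀ z e → jump z e ≤ L
  jump≤ z e with z <? e
  ... | yes _ = sep≤ L _ _
  ... | no  _ = z≤n

  jump-< : ∀ {z e} → z < e → jump z e ≡ dist z e
  jump-< {z} {e} p with z <? e
  ... | yes _ = refl
  ... | no ¬p = contradiction p ¬p

  jump⁻ : ∀ {z e} → 0 < jump z e → z < e × jump z e ≡ dist z e
  jump⁻ {z} {e} p with z <? e
  ... | yes q = q , refl
  ... | no  _ = contradiction p λ ()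

  dist-< : ∀ {z a b} → z ∈ Z → z < a → z < b → dist z a < dist z b → a < b
  dist-< z∈ z<a z<b p = rank-cancel-< Z (sep-< L (rank-< z∈ z<a) (rank-< z∈ z<b) p)

  dist>0 : ∀ {z a} → z ∈ Z → z < a → 0 < dist z a
  dist>0 {z} {a} z∈ z<a = n≢0⇒n>0 λ e → <-irrefl (sep≡0 L (bound z) (bound a) e) (rank-< z∈ z<a)

  -- Otherwise the steps from `z` to `v` and from `v` to `d` would have the same scale, which
  -- `sep-chain` excludes.
  no-tie : ∀ {z v e d} → z ∈ Z → v ∈ Z → z < v → z < e → jump z e ≡ jump v d → dist z v ≢ dist z e
  no-tie {z} {v} {e} {d} z∈ v∈ z<v z<e je q
    with jump⁻ {v} {d} (subst (0 <_) (trans (sym (jump-< z<e)) je) (dist>0 z∈ z<e))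
  ... | v<d , jd = sep-chain L (bound d) (rank-< z∈ z<v) (rank-< v∈ v<d)
                     (trans q (trans (sym (jump-< z<e)) (trans je jd)))

  -- Ties being excluded, the side of `e` on which a point above `z` lies is read off by comparing
  -- its scale from `z` with that of `e`, and `u` has the scale of `v`. In use, `e` is `f (z ∷ S)`
  -- and `d` is `f (v ∷ S)`.
  same-side : ∀ {z v u e d} → z ∈ Z → v ∈ Z → z < v → z < u → dist z v ≡ dist z u →
              jump z e ≡ jump v d → v < e → u < e
  same-side {z} {v} {u} {e} {d} z∈ v∈ z<v z<u dd jj v<e with <-cmp (dist z e) (dist z u)
  ... | tri< p _ _ = contradiction v<e (<⇒≯ (dist-< z∈ (<-trans z<v v<e) z<v (subst (dist z e <_) (sym dd) p)))
  ... | tri≈ _ p _ = contradiction (trans dd (sym p)) (no-tie {d = d} z∈ v∈ z<v (<-trans z<v v<e) jj)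
  ... | tri> _ _ p = dist-< z∈ z<u (<-trans z<v v<e) p

  -- The scale from `v` to `u` is smaller than that from `z` to `u`, which is smaller than the
  -- common scale of the two jumps; so the jump from `v` also passes `u`.
  later-jump : ∀ {z v u e d} → z ∈ Z → v ∈ Z → z < v → v < u → dist z v ≡ dist z u →
               jump z e ≡ jump v d → u < e → u < d
  later-jump {z} {v} {u} {e} {d} z∈ v∈ z<v v<u dd jj u<e = dist-< v∈ v<u (proj₁ j) (begin-strict
      dist v u  <⟨ sep-decreasing L (bound v) (bound u) (rank-< z∈ z<v) (rank-< z∈ z<u) dd ⟩
      dist z u  <⟨ zu<ze ⟩
      dist z e  ≡⟨ trans (sym (jump-< z<e)) (trans jj (proj₂ j)) ⟩
      dist v d  ∎)
    where
    open ≤-Reasoning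
    z<u = <-trans z<v v<u
    z<e = <-trans z<u u<e
    zu<ze : dist z u < dist z e
    zu<ze with <-cmp (dist z u) (dist z e)
    ... | tri< p _ _ = p
    ... | tri≈ _ p _ = contradiction (trans dd p) (no-tie {d = d} z∈ v∈ z<v z<e jj)
    ... | tri> _ _ p = contradiction u<e (<⇒≯ (dist-< z∈ z<e z<u p))
    j = jump⁻ {v} {d} (subst (0 <_) (trans (sym (jump-< z<e)) jj) (dist>0 z∈ z<e))

-- The limit point of a branch

take-vec : ∀ k → List ℕ → Vec ℕ k
take-vec zero    _       = []
-- Padding that makes the colourings total on lists; the conclusions are drawn from lists that come
-- from tuples of the right length.
take-vec (suc k) []      = 0 ∷ take-vec k []
take-vec (suc k) (x ∷ l) = x ∷ take-vec k l

take-vec-toList : ∀ {k} (S : Vec ℕ k) → take-vec k (Vec.toList S) ≡ S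
take-vec-toList []      = refl
take-vec-toList (x ∷ S) = cong (x ∷_) (take-vec-toList S)

toList-∈ : ∀ {k x} (S : Vec ℕ k) → x ∈ Vec.toList S → ∃[ i ] x ≡ lookup S i
toList-∈ (y ∷ S) (here e)  = zero , e
toList-∈ (y ∷ S) (there i) with toList-∈ S i
... | j , e = suc j , e

toList-⊏ : ∀ {k X} (S : Vec ℕ k) → S ⊏ X → Vec.toList S ⊑ X
toList-⊏ S h i with toList-∈ S i
... | j , refl = h j

toList-≫ : ∀ {k z z′} (S : Vec ℕ k) → z ≫ S → z′ ≫ S → ∀ {x} → x ∈ Vec.toList S → x < z × x < z′
toList-≫ S h h′ i with toList-∈ S i
... | j , refl = h j , h′ j

bit : ∀ {P : Set} → Dec P → ℕ
bit (yes _) = 1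
bit (no  _) = 0

bit<2 : ∀ {P : Set} (d : Dec P) → bit d < 2
bit<2 (yes _) = ≤-refl
bit<2 (no  _) = s≤s z≤n

bit-transfer : ∀ {P Q : Set} (d : Dec P) (e : Dec Q) → bit d ≡ bit e → P → Q
bit-transfer (yes _) (yes q) _ _ = q
bit-transfer (no ¬p) _       _ p = contradiction p ¬p

Injective : ∀ {k} {V : Set} → (Vec ℕ k → V) → List ℕ → Set
Injective F X = ∀ {S T} → Desc S → S ⊏ X → Desc T → T ⊏ X → F S ≡ F T → S ≡ T

-- The point w plays the role of infinity for the points in B.
record Limit {k : ℕ} {V : Set} (_≺_ : Rel V 0ℓ) (F : Vec ℕ (suc k) → V) (fs : List (Vec ℕ (suc (suc k)) → ℕ))
             (Z : List ℕ) (m : ℕ) : Set where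
  field
    B         : List ℕ
    w         : ℕ
    B⊑Z       : B ⊑ Z
    w∈Z       : w ∈ Z
    asc       : Asc B
    len       : length B ≡ m
    B<w       : ∀ {b} → b ∈ B → b < w
    to-limit  : ∀ {z S T} → S ⊏ B → T ⊏ B → z ∈ B → z ≫ S → z ≫ T → F (z ∷ S) ≺ F T → F (w ∷ S) ≺ F T
    of-limit  : ∀ {z S T} → S ⊏ B → T ⊏ B → z ∈ B → z ≫ S → z ≫ T → F (w ∷ S) ≺ F T → F (z ∷ S) ≺ F T
    of-limit₂ : ∀ {z S T} → S ⊏ B → T ⊏ B → z ∈ B → z ≫ S → z ≫ T → F (w ∷ S) ≺ F (w ∷ T) → F (z ∷ S) ≺ F (z ∷ T)
    f-to      : ∀ {f z v S} → f ∈ fs → S ⊏ B → z ∈ B → v ∈ B → z ≫ S → z < v → v < f (z ∷ S) → w < f (z ∷ S)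
    f-of      : ∀ {f z v S} → f ∈ fs → S ⊏ B → z ∈ B → v ∈ B → z ≫ S → z < v → w < f (z ∷ S) → v < f (z ∷ S)
    f-mono    : ∀ {f z v S} → f ∈ fs → S ⊏ B → z ∈ B → v ∈ B → z ≫ S → z < v → w < f (z ∷ S) → w < f (v ∷ S)

module MakeLimit {k : ℕ} {V : Set} {_≺_ : Rel V 0ℓ} (sto : IsStrictTotalOrder _≡_ _≺_)
  (F : Vec ℕ (suc k) → V) (fs : List (Vec ℕ (suc (suc k)) → ℕ)) (Z : List ℕ) (asc-Z : Asc Z)
  (L W m : ℕ) (|Z|<2^L : length Z < 2 ^ L)
  (few : suc (suc L) ^ ((3 + length fs) * (suc (suc m) ^ suc k * suc (suc m) ^ suc k)) ≤ 2 ^ W)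
  (large : 2 ^ (suc W * suc m) ≤ length Z) where

  open IsStrictTotalOrder sto using () renaming (_<?_ to _≺?_)
  open Scales L Z |Z|<2^L

  -- The two comparisons give the order fields of `Limit`. `distance` measures from an earlier
  -- point, the head of `l`; with the jump colours it supplies the hypotheses of `same-side` and
  -- `later-jump`.
  compare-tail compare-last distance : Colouring
  compare-tail l l′ z = bit (F (z ∷ take-vec k l) ≺? F (take-vec (suc k) l′))
  compare-last l l′ z = bit (F (z ∷ take-vec k l) ≺? F (z ∷ take-vec k l′))
  distance     l l′ z = dist (Vec.head (take-vec 1 l)) z

  jump-colour : (Vec ℕ (suc (suc k)) → ℕ) → Colouring
  jump-colour f l l′ z = jump z (f (z ∷ take-vec (suc k) l))

  colours : List Colouring
  colours = compare-tail ∷ compare-last ∷ distance ∷ map jump-colour fs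

  bounded : ∀ {c} → c ∈ colours → ∀ l l′ z → c l l′ z < suc (suc L)
  bounded (here refl)                 l l′ z = ≤-trans (bit<2 (F (z ∷ take-vec k l) ≺? F (take-vec (suc k) l′))) (s≤s (s≤s z≤n))
  bounded (there (here refl))         l l′ z = ≤-trans (bit<2 (F (z ∷ take-vec k l) ≺? F (z ∷ take-vec k l′))) (s≤s (s≤s z≤n))
  bounded (there (there (here refl))) l l′ z = s≤s (m≤n⇒m≤1+n (sep≤ L _ _))
  bounded (there (there (there i)))   l l′ z with ∈-map⁻ jump-colour i
  ... | f , _ , refl = s≤s (m≤n⇒m≤1+n (jump≤ z (f (z ∷ take-vec (suc k) l))))

  -- Scales take values from 0 to `L`; one more colour makes room for the two values of a bit even
  -- if `L` is 0. Lists need up to k+1 entries in `compare-tail` and in the jump colours, and the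
  -- extra point of the branch becomes `w`.
  open EndHomogeneous (suc (suc L)) (suc k) W (suc m) colours bounded
    (subst (λ t → suc (suc L) ^ ((3 + t) * (suc (suc m) ^ suc k * suc (suc m) ^ suc k)) ≤ 2 ^ W)
      (sym (List.length-map jump-colour fs)) few) z<s

  Homogeneous : List ℕ → Set
  Homogeneous Y = ∀ {c l l′ z z′} → c ∈ colours → length l ≤ suc k → length l′ ≤ suc k → l ⊑ Y → l′ ⊑ Y → z ∈ Y → z′ ∈ Y →
    (∀ {x} → x ∈ l → x < z × x < z′) → (∀ {x} → x ∈ l′ → x < z × x < z′) → c l l′ z ≡ c l l′ z′

  module _ {Y B : List ℕ} {w : ℕ} (Y⊑Z : Y ⊑ Z) (hom : Homogeneous Y) (B⊑Y : B ⊑ Y) (w∈ : w ∈ Y)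
           (<w : ∀ {b} → b ∈ B → b < w) where

    w≫ : ∀ {z l} {S : Vec ℕ l} → z ∈ B → z ≫ S → w ≫ S
    w≫ z∈ h i = <-trans (h i) (<w z∈)
    length≤ : ∀ {l} (S : Vec ℕ l) → length (Vec.toList S) ≤ l
    length≤ S = ≤-reflexive (Vec.length-toList S)
    tail-eq : ∀ {z} S T → S ⊏ B → T ⊏ B → z ∈ B → z ≫ S → z ≫ T → bit (F (z ∷ S) ≺? F T) ≡ bit (F (w ∷ S) ≺? F T)
    tail-eq {z} S T iS iT z∈ z≫S z≫T =
      subst₂ (λ A B → bit (F (z ∷ A) ≺? F B) ≡ bit (F (w ∷ A) ≺? F B)) (take-vec-toList S) (take-vec-toList T)
        (hom {l = Vec.toList S} {l′ = Vec.toList T} (here refl) (m≤n⇒m≤1+n (length≤ S)) (length≤ T)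
             (B⊑Y ∘ toList-⊏ S iS) (B⊑Y ∘ toList-⊏ T iT) (B⊑Y z∈) w∈
             (toList-≫ S z≫S (w≫ {S = S} z∈ z≫S)) (toList-≫ T z≫T (w≫ {S = T} z∈ z≫T)))
    last-eq : ∀ {z} S T → S ⊏ B → T ⊏ B → z ∈ B → z ≫ S → z ≫ T →
              bit (F (z ∷ S) ≺? F (z ∷ T)) ≡ bit (F (w ∷ S) ≺? F (w ∷ T))
    last-eq {z} S T iS iT z∈ z≫S z≫T =
      subst₂ (λ A B → bit (F (z ∷ A) ≺? F (z ∷ B)) ≡ bit (F (w ∷ A) ≺? F (w ∷ B))) (take-vec-toList S) (take-vec-toList T)
        (hom {l = Vec.toList S} {l′ = Vec.toList T} (there (here refl)) (m≤n⇒m≤1+n (length≤ S)) (m≤n⇒m≤1+n (length≤ T))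
             (B⊑Y ∘ toList-⊏ S iS) (B⊑Y ∘ toList-⊏ T iT) (B⊑Y z∈) w∈
             (toList-≫ S z≫S (w≫ {S = S} z∈ z≫S)) (toList-≫ T z≫T (w≫ {S = T} z∈ z≫T)))
    dist-eq : ∀ {z v} → z ∈ B → v ∈ Y → z < v → dist z v ≡ dist z w
    dist-eq {z} z∈ v∈ z<v = hom {l = z ∷ []} {l′ = []} (there (there (here refl))) (s≤s z≤n) z≤n
      (λ { (here refl) → B⊑Y z∈ }) (λ ()) v∈ w∈ (λ { (here refl) → z<v , <w z∈ }) (λ ())
    jump-eq : ∀ {f z v} S → f ∈ fs → S ⊏ B → z ∈ B → v ∈ Y → z ≫ S → z < v → jump z (f (z ∷ S)) ≡ jump v (f (v ∷ S))
    jump-eq {f} {z} {v} S f∈ iS z∈ v∈ z≫ z<v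
      = subst (λ A → jump z (f (z ∷ A)) ≡ jump v (f (v ∷ A))) (take-vec-toList S)
        (hom {l = Vec.toList S} {l′ = []} (there (there (there (∈-map⁺ jump-colour f∈)))) (length≤ S) z≤n
             (B⊑Y ∘ toList-⊏ S iS) (λ ()) (B⊑Y z∈) v∈ (toList-≫ S z≫ (λ i → <-trans (z≫ i) z<v)) (λ ()))

    top-limit : Asc B → length B ≡ m → Limit _≺_ F fs Z m
    top-limit asc-B len-B = record
      { B = B ; w = w ; B⊑Z = Y⊑Z ∘ B⊑Y ; w∈Z = Y⊑Z w∈ ; asc = asc-B ; len = len-B
      ; B<w = <w
      ; to-limit  = λ {z} {S} {T} iS iT z∈ z≫S z≫T → bit-transfer (F (z ∷ S) ≺? F T) (F (w ∷ S) ≺? F T)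
                      (tail-eq S T iS iT z∈ z≫S z≫T)
      ; of-limit  = λ {z} {S} {T} iS iT z∈ z≫S z≫T → bit-transfer (F (w ∷ S) ≺? F T) (F (z ∷ S) ≺? F T)
                      (sym (tail-eq S T iS iT z∈ z≫S z≫T))
      ; of-limit₂ = λ {z} {S} {T} iS iT z∈ z≫S z≫T → bit-transfer (F (w ∷ S) ≺? F (w ∷ T)) (F (z ∷ S) ≺? F (z ∷ T))
                      (sym (last-eq S T iS iT z∈ z≫S z≫T))
      ; f-to   = λ {f} {z} {v} {S} f∈ iS z∈ v∈ z≫ z<v → same-side {z} {v} {w} {f (z ∷ S)} {f (v ∷ S)} (Y⊑Z (B⊑Y z∈)) (Y⊑Z (B⊑Y v∈)) z<v (<w z∈)
                   (dist-eq z∈ (B⊑Y v∈) z<v) (jump-eq S f∈ iS z∈ (B⊑Y v∈) z≫ z<v)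
      -- The later points exchange roles: `w` is now the point known to be passed, so the jump from
      -- `z` is matched with the one from `w`.
      ; f-of   = λ {f} {z} {v} {S} f∈ iS z∈ v∈ z≫ z<v → same-side {z} {w} {v} {f (z ∷ S)} {f (w ∷ S)} (Y⊑Z (B⊑Y z∈)) (Y⊑Z w∈) (<w z∈) z<v
                   (sym (dist-eq z∈ (B⊑Y v∈) z<v)) (jump-eq S f∈ iS z∈ w∈ z≫ (<w z∈))
      ; f-mono = λ {f} {z} {v} {S} f∈ iS z∈ v∈ z≫ z<v → later-jump {z} {v} {w} {f (z ∷ S)} {f (v ∷ S)} (Y⊑Z (B⊑Y z∈)) (Y⊑Z (B⊑Y v∈)) z<v (<w v∈)
                   (dist-eq z∈ (B⊑Y v∈) z<v) (jump-eq S f∈ iS z∈ (B⊑Y v∈) z≫ z<v)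
      }

  limit : Limit _≺_ F fs Z m
  limit = cut-off (endHomogeneous Z asc-Z large)
    where
    cut-off : ∃[ Y ] Y ⊑ Z × Asc Y × length Y ≡ suc m × Homogeneous Y → Limit _≺_ F fs Z m
    cut-off (Y , Y⊑Z , asc-Y , len-Y , hom) = top (split-asc m asc-Y (≤-trans (n≤1+n m) (≤-reflexive (sym len-Y))))
      where
      top : ∃[ B ] ∃[ R ] Asc B × Asc R × B ⊑ Y × R ⊑ Y ×
              length B ≡ m × m + length R ≡ length Y × (∀ {b r} → b ∈ B → r ∈ R → b < r) → Limit _≺_ F fs Z m
      top (B , []    , _ , _ , _ , _ , _ , len-R , _) =
        contradiction (trans (sym (+-identityʳ m)) (trans len-R len-Y)) (<⇒≢ ≤-refl)
      top (B , w ∷ _ , asc-B , _ , B⊑Y , R⊑Y , len-B , _ , B<R) =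
        top-limit Y⊑Z hom B⊑Y (R⊑Y (here refl)) (λ i → B<R i (here refl)) asc-B len-B

-- Canonised orderings and their extension by the last coordinate

record Canonised {k : ℕ} {V : Set} (_≺_ : Rel V 0ℓ) (F : Vec ℕ k → V) (X : List ℕ) : Set where
  field
    code     : Code k
    complete : Complete code
    distinct : Distinct code
    lex      : ∀ {S T} → Desc S → S ⊏ X → Desc T → T ⊏ X → Lex code S T → F S ≺ F T

canonised-flip : ∀ {k V} {_≺_ : Rel V 0ℓ} {F : Vec ℕ k → V} {X} → Canonised _≺_ F X → Canonised (flip _≺_) F X
canonised-flip c = record
  { code = reverse code ; complete = complete-reverse {c = code} complete ; distinct = distinct-reverse distinct
  ; lex = λ {S} {T} dS iS dT iT l → lex {T} {S} dT iT dS iS (lex-reverse code l) }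
  where open Canonised c

canonised-⊑ : ∀ {k V} {_≺_ : Rel V 0ℓ} {F : Vec ℕ k → V} {X Y} → X ⊑ Y → Canonised _≺_ F Y → Canonised _≺_ F X
canonised-⊑ h c = record
  { code = code ; complete = complete ; distinct = distinct
  ; lex = λ {S} {T} dS iS dT iT l → lex {S} {T} dS (h ∘ iS) dT (h ∘ iT) l }
  where open Canonised c

module Extension {k : ℕ} {V : Set} {_≺_ : Rel V 0ℓ} (sto : IsStrictTotalOrder _≡_ _≺_)
  (F : Vec ℕ (suc k) → V) (w : ℕ) (B : List ℕ) where

  open IsStrictTotalOrder sto using () renaming (_<?_ to _≺?_; trans to ≺-trans; compare to ≺-cmp)

  G : Vec ℕ k → V
  G S = F (w ∷ S)

  -- For fixed Q this condition on z is closed downwards, so reach turns it into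
  -- a comparison with z.
  Reaches : Fin k × Bool → Vec ℕ (suc k) → ℕ → Set
  Reaches (p , s) Q z =
    z ≫ Q × F (z ∷ pick s p Q) ≺ G (pick s p Q) × F (z ∷ pick s p Q) ≺ G (pick (not s) p Q)

  reaches? : ∀ x Q z → Dec (Reaches x Q z)
  reaches? (p , s) Q z = Fin.all? (λ i → lookup Q i <? z) ×-dec
    (F (z ∷ pick s p Q) ≺? G (pick s p Q)) ×-dec (F (z ∷ pick s p Q) ≺? G (pick (not s) p Q))

  reach : Fin k × Bool → Vec ℕ (suc k) → ℕ
  reach x Q = threshold (reaches? x Q) B

  module _
    (below : ∀ {z S T} → Desc S → S ⊏ B → Desc T → T ⊏ B → z ∈ B → z ≫ S → z ≫ T → F T ≺ G S → F T ≺ F (z ∷ S))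
    (above : ∀ {z S T} → Desc S → S ⊏ B → Desc T → T ⊏ B → z ∈ B → z ≫ S → z ≫ T → G S ≺ F T → F (z ∷ S) ≺ F T)
    (same : ∀ {z S T} → Desc S → S ⊏ B → Desc T → T ⊏ B → z ∈ B → z ≫ S → z ≫ T → G S ≺ G T → F (z ∷ S) ≺ F (z ∷ T))
    (apart : ∀ {z S T} → Desc S → S ⊏ B → Desc T → T ⊏ B → z ∈ B → z ≫ S → F (z ∷ S) ≢ G T)
    (X₀ : List ℕ) (X₀⊑B : X₀ ⊑ B)
    (increasing : ∀ {z S} → Desc S → S ⊏ X₀ → z ∈ X₀ → z ≫ S → F (z ∷ S) ≺ G S)
    (canonG : Canonised _≺_ G X₀) (uniform : ∀ x → Uniform (reach x) X₀) where

    open Insertion _≺_ ≺-trans F G X₀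
    open Canonised canonG

    -- A threshold above `z` has a witness `v` that is not below `z`. Since `F` increases in the
    -- last coordinate, what holds at `v` carries over to `z`.
    big⇒yields : ∀ x → Big (reach x) X₀ → Yields x
    big⇒yields x@(p , s) big {Q} {z} (mkOk dQ iQ) z∈ z≫ = go (threshold-witness (reaches? x Q) {B} (big {Q} {z} dQ iQ z∈ z≫))
      where
      A = pick s p Q
      dA : Desc A
      dA = desc-pick s p dQ
      iA : A ⊏ X₀
      iA = ⊏-pick s p iQ
      z≫A : z ≫ A
      z≫A = ≫-pick s p z≫
      go : ∃[ v ] v ∈ B × Reaches x Q v × z ≤ v → F (z ∷ A) ≺ G (pick (not s) p Q)
      go (v , v∈ , (v≫ , _ , r) , z≤v) with m≤n⇒m<n∨m≡n z≤v
      ... | inj₂ refl = r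
      ... | inj₁ z<v  = ≺-trans (below {v} {A} {z ∷ A} dA (X₀⊑B ∘ iA) (desc-∷ z≫A dA) (⊏-∷ (X₀⊑B z∈) (X₀⊑B ∘ iA)) v∈ (≫-pick s p v≫)
                          (≫-∷ z<v (≫-pick s p v≫)) (increasing dA iA z∈ z≫A)) r

    small⇒dominates : ∀ x → Small (reach x) X₀ → Dominates x
    small⇒dominates x@(p , s) small {Q} {z} (mkOk dQ iQ) z∈ z≫ = go (≺-cmp (F (z ∷ A)) (G (pick (not s) p Q)))
      where
      A = pick s p Q
      dA : Desc A
      dA = desc-pick s p dQ
      iA : A ⊏ X₀
      iA = ⊏-pick s p iQ
      z≫A : z ≫ A
      z≫A = ≫-pick s p z≫
      go : Tri (F (z ∷ A) ≺ G (pick (not s) p Q)) (F (z ∷ A) ≡ G (pick (not s) p Q)) (G (pick (not s) p Q) ≺ F (z ∷ A)) →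
           G (pick (not s) p Q) ≺ F (z ∷ A)
      go (tri< r _ _) = contradiction (<-threshold (reaches? x Q) (X₀⊑B z∈) (z≫ , increasing dA iA z∈ z≫A , r))
                          (≤⇒≯ (small {Q} {z} dQ iQ z∈ z≫))
      go (tri≈ _ e _) = contradiction e (apart dA (X₀⊑B ∘ iA) (desc-pick (not s) p dQ) (X₀⊑B ∘ ⊏-pick (not s) p iQ) (X₀⊑B z∈) z≫A)
      go (tri> _ _ r) = r

    module _ (X X′ : List ℕ) (X⊑X₀ : X ⊑ X₀) (notched : Notched X X₀) (τ₁ τ₂ : ℕ) (τ₁∈ : τ₁ ∈ X) (τ₂∈ : τ₂ ∈ X)
             (τ₁<τ₂ : τ₁ < τ₂) (X′⊑X : X′ ⊑ X) (X′<τ₁ : ∀ {x} → x ∈ X′ → x < τ₁) where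

      extend : Canonised _≺_ F X′
      extend = build (cut code (λ {x} _ → [ inj₁ ∘ big⇒yields x , inj₂ ∘ small⇒dominates x ]′ (uniform x)))
        where
        build : ∃[ c₁ ] ∃[ c₂ ] code ≡ c₁ ++ c₂ × (∀ {x} → x ∈ c₁ → Dominates x) × HeadYields c₂ → Canonised _≺_ F X′
        build (c₁ , c₂ , e , dominates , yields) = record
          { code = insert c₁ c₂ true
          ; complete = complete-insert c₁ c₂ true (subst Complete e complete)
          ; distinct = distinct-insert c₁ c₂ true (subst Distinct e distinct)
          ; lex = λ {S} {T} dS iS dT iT l → lexF
              (λ { (mkOk dS iS) z∈ z≫ → increasing dS iS z∈ z≫ })
              (λ { (mkOk dS iS) (mkOk dT iT) z∈ → below dS (X₀⊑B ∘ iS) dT (X₀⊑B ∘ iT) (X₀⊑B z∈) })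
              (λ { (mkOk dS iS) (mkOk dT iT) z∈ → above dS (X₀⊑B ∘ iS) dT (X₀⊑B ∘ iT) (X₀⊑B z∈) })
              (λ { (mkOk dS iS) (mkOk dT iT) z∈ → same dS (X₀⊑B ∘ iS) dT (X₀⊑B ∘ iT) (X₀⊑B z∈) })
              c₁ c₂
              (λ { {S} {T} (mkOk dS iS) (mkOk dT iT) l → lex {S} {T} dS iS dT iT (subst (λ c → Lex c S T) (sym e) l) })
              (subst Complete e complete) (subst Distinct e distinct) dominates yields X X⊑X₀ notched
              {τ₁} {τ₂} {S} {T} τ₁∈ τ₂∈ τ₁<τ₂ dS (X′⊑X ∘ iS) dT (X′⊑X ∘ iT) (X′<τ₁ ∘ iS) (X′<τ₁ ∘ iT) l
          }

-- The induction step

record Selection {k : ℕ} {V : Set} (_≺_ : Rel V 0ℓ) (F : Vec ℕ k → V) (fs : List (Vec ℕ (suc k) → ℕ)) (n : ℕ) (Y : List ℕ) : Set where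
  field
    X         : List ℕ
    X⊑Y       : X ⊑ Y
    asc       : Asc X
    len       : length X ≡ n
    canonised : Canonised _≺_ F X
    uniform   : ∀ {f} → f ∈ fs → Uniform f X

-- Counts the functions made uniform one level down: `start` for each of the `r` given ones, `sign`,
-- and `reach` for k positions with two directions, once for increasing and once for decreasing `F`.
auxiliary : ℕ → ℕ → ℕ
auxiliary k r = r + suc (k * 2 + k * 2)

-- The inner 2 stands for the two top points of `lexF`, and the doubling leaves room for notches. Of
-- the two outer points one is the lowest notch, the other the test point `t` of `signed`.
enlarged : ℕ → ℕ
enlarged n = suc (suc ((n + 2) * 2))

module Step {k : ℕ} {V : Set} {_≺_ : Rel V 0ℓ} (sto : IsStrictTotalOrder _≡_ _≺_)
  (F : Vec ℕ (suc k) → V) (fs : List (Vec ℕ (suc (suc k)) → ℕ)) (Z : List ℕ) (injective : Injective F Z)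
  (m n : ℕ) (lim : Limit _≺_ F fs Z m) where

  open Limit lim
  open IsStrictTotalOrder sto using () renaming (_<?_ to _≺?_; compare to ≺-cmp; asym to ≺-asym)

  module Up   = Extension sto F w B
  -- For `F` decreasing in the last coordinate the argument runs in the reversed order, and the
  -- resulting code is reversed afterwards.
  module Down = Extension (Flip.isStrictTotalOrder sto) F w B

  G : Vec ℕ k → V
  G = Up.G

  positions : List (Fin k × Bool)
  positions = cartesianProduct (allFin k) (true ∷ false ∷ [])

  ∈-positions : ∀ x → x ∈ positions
  ∈-positions (p , true)  = ∈-cartesianProduct⁺ (∈-allFin p) (here refl)
  ∈-positions (p , false) = ∈-cartesianProduct⁺ (∈-allFin p) (there (here refl))

  small-at? : ∀ (f : Vec ℕ (suc (suc k)) → ℕ) S z → Dec (z ≫ S × ¬ (w < f (z ∷ S)))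
  small-at? f S z = Fin.all? (λ i → lookup S i <? z) ×-dec ¬? (w <? f (z ∷ S))

  -- By f-mono the points z with f (z ∷ S) ≤ w form an initial segment of the
  -- points above S; start f S is its end.
  start : (Vec ℕ (suc (suc k)) → ℕ) → Vec ℕ (suc k) → ℕ
  start f S = threshold (small-at? f S) B

  -- The values 0 and suc w encode a 2-colouring: uniformity makes it constant.
  sign : Vec ℕ (suc k) → ℕ
  sign T = bit (F T ≺? G (Vec.tail T)) * suc w

  gs : List (Vec ℕ (suc k) → ℕ)
  gs = map start fs ++ sign ∷ (map Up.reach positions ++ map Down.reach positions)

  length-gs : length gs ≡ auxiliary k (length fs)
  length-gs = trans (List.length-++ (map start fs)) (cong₂ (λ a b → a + suc b) (List.length-map start fs)
    (trans (List.length-++ (map Up.reach positions)) (cong₂ _+_ (len-pos Up.reach) (len-pos Down.reach))))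
    where
    len-pos : ∀ (g : Fin k × Bool → Vec ℕ (suc k) → ℕ) → length (map g positions) ≡ k * 2
    len-pos g = trans (List.length-map g positions) (trans (length-cartesianProductWith _,_ (allFin k) _)
      (cong (_* 2) (List.length-tabulate {n = k} id)))

  z∷-⊏ : ∀ {l z} {S : Vec ℕ l} → z ∈ Z → S ⊏ B → (z ∷ S) ⊏ Z
  z∷-⊏ z∈ iS = ⊏-∷ z∈ (B⊑Z ∘ iS)

  w≫ : ∀ {l} {S : Vec ℕ l} → S ⊏ B → w ≫ S
  w≫ iS i = B<w (iS i)

  injective-G : Injective G B
  injective-G {S} {T} dS iS dT iT e with injective {w ∷ S} {w ∷ T}
    (desc-∷ (w≫ {S = S} iS) dS) (z∷-⊏ {S = S} w∈Z iS) (desc-∷ (w≫ {S = T} iT) dT) (z∷-⊏ {S = T} w∈Z iT) e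
  ... | refl = refl

  F≢F : ∀ {z S T} → Desc S → S ⊏ B → Desc T → T ⊏ B → z ∈ B → z ≫ S → z ≫ T → F (z ∷ S) ≢ F T
  F≢F {z} {S} {T} dS iS dT iT z∈ z≫S z≫T e
    with injective {z ∷ S} {T} (desc-∷ z≫S dS) (z∷-⊏ {S = S} (B⊑Z z∈) iS) dT (B⊑Z ∘ iT) e
  ... | refl = <-irrefl refl (z≫T zero)

  apart : ∀ {z S T} → Desc S → S ⊏ B → Desc T → T ⊏ B → z ∈ B → z ≫ S → F (z ∷ S) ≢ G T
  apart {z} {S} {T} dS iS dT iT z∈ z≫ e
    with injective {z ∷ S} {w ∷ T} (desc-∷ z≫ dS) (z∷-⊏ {S = S} (B⊑Z z∈) iS)
           (desc-∷ (w≫ {S = T} iT) dT) (z∷-⊏ {S = T} w∈Z iT) e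
  ... | refl = <-irrefl refl (B<w z∈)

  below : ∀ {z S T} → Desc S → S ⊏ B → Desc T → T ⊏ B → z ∈ B → z ≫ S → z ≫ T → F T ≺ G S → F T ≺ F (z ∷ S)
  below {z} {S} {T} dS iS dT iT z∈ z≫S z≫T r with ≺-cmp (F T) (F (z ∷ S))
  ... | tri< q _ _ = q
  ... | tri≈ _ e _ = contradiction (sym e) (F≢F dS iS dT iT z∈ z≫S z≫T)
  ... | tri> _ _ q = contradiction r (≺-asym (to-limit iS iT z∈ z≫S z≫T q))

  above′ : ∀ {z S T} → Desc S → S ⊏ B → Desc T → T ⊏ B → z ∈ B → z ≫ S → z ≫ T → G S ≺ F T → F (z ∷ S) ≺ F T
  above′ dS iS dT iT z∈ z≫S z≫T = of-limit iS iT z∈ z≫S z≫T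

  same : ∀ {z S T} → Desc S → S ⊏ B → Desc T → T ⊏ B → z ∈ B → z ≫ S → z ≫ T → G S ≺ G T → F (z ∷ S) ≺ F (z ∷ T)
  same dS iS dT iT z∈ z≫S z≫T = of-limit₂ iS iT z∈ z≫S z≫T

  -- Testing `f (z ∷ S)` against a later point amounts to testing it against `w`, which for fixed
  -- `S` succeeds exactly from `start f S` on. Hence big and small change places.
  uniform-start : ∀ {f X} → f ∈ fs → X ⊑ B → Uniform (start f) X → Uniform f X
  uniform-start {f} {X} f∈ X⊑B (inj₂ small) = inj₁ big
    where
    big : Big f X
    big {z ∷ S} {v} d i v∈ v≫ = f-of f∈ (X⊑B ∘ i ∘ suc) (X⊑B (i zero)) (X⊑B v∈) (desc-head d) (v≫ zero) (go (w <? f (z ∷ S)))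
      where
      go : Dec (w < f (z ∷ S)) → w < f (z ∷ S)
      go (yes p) = p
      go (no ¬p) = contradiction (<-threshold (small-at? f S) (X⊑B (i zero)) (desc-head d , ¬p))
                     (≤⇒≯ (small {S} {z} (desc-tail d) (i ∘ suc) (i zero) (desc-head d)))
  uniform-start {f} {X} f∈ X⊑B (inj₁ big) = inj₂ small
    where
    small : Small f X
    small {z ∷ S} {v} d i v∈ v≫ = ≮⇒≥ λ v<f →
      go (f-to f∈ iS (X⊑B (i zero)) (X⊑B v∈) (desc-head d) (v≫ zero) v<f)
         (threshold-witness (small-at? f S) {B} (big {S} {z} (desc-tail d) (i ∘ suc) (i zero) (desc-head d)))
      where
      iS : S ⊏ B
      iS = X⊑B ∘ i ∘ suc
      go : w < f (z ∷ S) → ∃[ u ] u ∈ B × (u ≫ S × ¬ (w < f (u ∷ S))) × z ≤ u → ⊥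
      go w<f (u , u∈ , (_ , ¬p) , z≤u) with m≤n⇒m<n∨m≡n z≤u
      ... | inj₂ refl = ¬p w<f
      ... | inj₁ z<u  = ¬p (f-mono f∈ iS (X⊑B (i zero)) u∈ (desc-head d) z<u w<f)

  -- Uniformity speaks only of tuples below some tested point; `t` lies above all of `X₀` and so
  -- tests every tuple there. Being smaller than `w`, it separates the two values of `sign`.
  signed : ∀ {X₀ t} → X₀ ⊑ B → t ∈ B → (∀ {x} → x ∈ X₀ → x < t) → Uniform sign (t ∷ X₀) →
    (∀ {z S} → Desc S → S ⊏ X₀ → z ∈ X₀ → z ≫ S → F (z ∷ S) ≺ G S) ⊎
    (∀ {z S} → Desc S → S ⊏ X₀ → z ∈ X₀ → z ≫ S → G S ≺ F (z ∷ S))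
  signed {X₀} {t} X₀⊑B t∈ X₀<t (inj₁ big) = inj₁ λ {z} {S} dS iS z∈ z≫ →
    go (F (z ∷ S) ≺? G S) (big {z ∷ S} {t} (desc-∷ z≫ dS) (there ∘ ⊏-∷ {S = S} z∈ iS) (here refl)
      (≫-∷ (X₀<t z∈) (λ i → X₀<t (iS i))))
    where
    go : ∀ {P : Set} (d : Dec P) → t < bit d * suc w → P
    go (yes p) _ = p
  signed {X₀} {t} X₀⊑B t∈ X₀<t (inj₂ small) = inj₂ λ {z} {S} dS iS z∈ z≫ →
    go dS (X₀⊑B ∘ iS) (X₀⊑B z∈) z≫ (≺-cmp (F (z ∷ S)) (G S)) (F (z ∷ S) ≺? G S) (small {z ∷ S} {t} (desc-∷ z≫ dS) (there ∘ ⊏-∷ {S = S} z∈ iS) (here refl)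
      (≫-∷ (X₀<t z∈) (λ i → X₀<t (iS i))))
    where
    go : ∀ {z S} → Desc S → S ⊏ B → z ∈ B → z ≫ S → Tri (F (z ∷ S) ≺ G S) (F (z ∷ S) ≡ G S) (G S ≺ F (z ∷ S)) →
         (d : Dec (F (z ∷ S) ≺ G S)) → bit d * suc w ≤ t → G S ≺ F (z ∷ S)
    go dS iS z∈ z≫ (tri> _ _ r) _       _ = r
    go dS iS z∈ z≫ (tri≈ _ e _) _       _ = contradiction e (apart dS iS dS iS z∈ z≫)
    go dS iS z∈ z≫ (tri< r _ _) (no ¬r) _ = contradiction r ¬r
    go dS iS z∈ z≫ (tri< r _ _) (yes _) q = contradiction (<-trans (B<w t∈) (subst (_≤ t) (+-identityʳ (suc w)) q)) (<-irrefl refl)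

  module _ (sel : Selection _≺_ G gs (enlarged n) B) where

    private module S = Selection sel

    extract : ∀ {t X₀ a X₁ Xᵇ X′ τ₁ τ₂} → (t ∷ X₀) ⊑ S.X → (∀ {x} → x ∈ X₀ → x < t) → (a ∷ X₁) ≡ X₀ →
      Xᵇ ⊑ X₁ → Notched Xᵇ (a ∷ X₁) → X′ ⊑ Xᵇ → Asc X′ → length X′ ≡ n → τ₁ ∈ Xᵇ → τ₂ ∈ Xᵇ → τ₁ < τ₂ →
      (∀ {x} → x ∈ X′ → x < τ₁) → Selection _≺_ F fs n Z
    extract {t} {X₀} {a} {X₁} {Xᵇ} {X′} {τ₁} {τ₂} sub X₀<t refl subᵇ notched sub′ asc′ len′ τ₁∈ τ₂∈ τ₁<τ₂ X′<τ₁ = record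
      { X = X′ ; X⊑Y = B⊑Z ∘ X′⊑B ; asc = asc′ ; len = len′
      ; canonised = by-sign (signed X₀⊑B t∈B X₀<t (uniform-⊑ sub (S.uniform (∈-++⁺ʳ (map start fs) (here refl)))))
      ; uniform = λ f∈ → uniform-start f∈ X′⊑B (uniform-⊑ (S⊑ ∘ sub₀) (S.uniform (∈-++⁺ˡ (∈-map⁺ start f∈))))
      }
      where
      sub₀ : X′ ⊑ X₀
      sub₀ = there ∘ subᵇ ∘ sub′
      S⊑ : X₀ ⊑ S.X
      S⊑ = sub ∘ there
      X₀⊑B : X₀ ⊑ B
      X₀⊑B = S.X⊑Y ∘ S⊑
      X′⊑B : X′ ⊑ B
      X′⊑B = X₀⊑B ∘ sub₀
      t∈B : t ∈ B
      t∈B = S.X⊑Y (sub (here refl))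
      canonG : Canonised _≺_ G X₀
      canonG = canonised-⊑ S⊑ S.canonised
      by-sign : _ → Canonised _≺_ F X′
      by-sign (inj₁ up) = Up.extend below above′ same apart X₀ X₀⊑B up canonG
        (λ x → uniform-⊑ S⊑ (S.uniform (∈-++⁺ʳ (map start fs) (there (∈-++⁺ˡ (∈-map⁺ Up.reach (∈-positions x)))))))
        Xᵇ X′ (there ∘ subᵇ) notched τ₁ τ₂ τ₁∈ τ₂∈ τ₁<τ₂ sub′ X′<τ₁
      by-sign (inj₂ down) = canonised-flip (Down.extend above′ below
        (λ {z} {S} {T} dS iS dT iT z∈ z≫S z≫T → same {z} {T} {S} dT iT dS iS z∈ z≫T z≫S) apart X₀ X₀⊑B down (canonised-flip canonG)
        (λ x → uniform-⊑ S⊑ (S.uniform (∈-++⁺ʳ (map start fs) (there (∈-++⁺ʳ (map Up.reach positions) (∈-map⁺ Down.reach (∈-positions x)))))))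
        Xᵇ X′ (there ∘ subᵇ) notched τ₁ τ₂ τ₁∈ τ₂∈ τ₁<τ₂ sub′ X′<τ₁)

    two-tops : ∀ (Xᵇ : List ℕ) → Asc Xᵇ → length Xᵇ ≡ n + 2 →
      ∃[ X′ ] ∃[ τ₁ ] ∃[ τ₂ ] X′ ⊑ Xᵇ × Asc X′ × length X′ ≡ n × τ₁ ∈ Xᵇ × τ₂ ∈ Xᵇ × τ₁ < τ₂ × (∀ {x} → x ∈ X′ → x < τ₁)
    two-tops Xᵇ ascᵇ lenᵇ = go (split-asc n ascᵇ (≤-trans (m≤m+n n 2) (≤-reflexive (sym lenᵇ))))
      where
      go : ∃[ X′ ] ∃[ R ] Asc X′ × Asc R × X′ ⊑ Xᵇ × R ⊑ Xᵇ × length X′ ≡ n × n + length R ≡ length Xᵇ ×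
             (∀ {b r} → b ∈ X′ → r ∈ R → b < r) →
           ∃[ X′ ] ∃[ τ₁ ] ∃[ τ₂ ] X′ ⊑ Xᵇ × Asc X′ × length X′ ≡ n × τ₁ ∈ Xᵇ × τ₂ ∈ Xᵇ × τ₁ < τ₂ × (∀ {x} → x ∈ X′ → x < τ₁)
      go (X′ , R , asc′ , ascR , sub′ , subR , len′ , lenR , X′<R)
        with R | +-cancelˡ-≡ n (length R) 2 (trans lenR lenᵇ) | ascR | subR | X′<R
      ... | τ₁ ∷ τ₂ ∷ [] | refl | (τ₁<τ₂ ∷ []) ∷ _ | subR | X′<R =
        X′ , τ₁ , τ₂ , sub′ , asc′ , len′ , subR (here refl) , subR (there (here refl)) , τ₁<τ₂ , λ i → X′<R i (here refl)

    select : Selection _≺_ F fs n Z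
    select = go (split-asc (suc ((n + 2) * 2)) S.asc (≤-trans (n≤1+n _) (≤-reflexive (sym S.len))))
      where
      go : ∃[ X₀ ] ∃[ R ] Asc X₀ × Asc R × X₀ ⊑ S.X × R ⊑ S.X × length X₀ ≡ suc ((n + 2) * 2) ×
             suc ((n + 2) * 2) + length R ≡ length S.X × (∀ {b r} → b ∈ X₀ → r ∈ R → b < r) → Selection _≺_ F fs n Z
      go (_ , [] , _ , _ , _ , _ , _ , lenR , _) =
        contradiction (trans (sym (+-identityʳ _)) (trans lenR S.len)) (<⇒≢ ≤-refl)
      go (a ∷ X₁ , t ∷ _ , asc₀ , _ , sub₀ , subR , len₀ , _ , X₀<R)
        with thin (n + 2) a X₁ asc₀ (≤-reflexive (sym (suc-injective len₀)))
      ... | Xᵇ , subᵇ , ascᵇ , lenᵇ , notched with two-tops Xᵇ ascᵇ lenᵇ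
      ...   | X′ , τ₁ , τ₂ , sub′ , asc′ , len′ , τ₁∈ , τ₂∈ , τ₁<τ₂ , X′<τ₁ =
        extract {t} {a ∷ X₁} {a} {X₁} (λ { (here refl) → subR (here refl) ; (there i) → sub₀ i }) (λ i → X₀<R i (here refl)) refl
          subᵇ notched sub′ asc′ len′ τ₁∈ τ₂∈ τ₁<τ₂ X′<τ₁

-- Bounds

1+n≤2^n : ∀ n → suc n ≤ 2 ^ n
1+n≤2^n zero    = ≤-refl
1+n≤2^n (suc n) = +-mono-≤ (m^n>0 2 n) (≤-trans (1+n≤2^n n) (m≤m+n _ 0))

-- Starts with 28 ≤ 32 and fails at D = 4, which is where the summand 5 in the choice of D comes
-- from.
square<2^ : ∀ D → 5 ≤ D → suc (suc (suc (D * D))) ≤ 2 ^ D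
square<2^ D 5≤D = subst (λ D → suc (suc (suc (D * D))) ≤ 2 ^ D) (m+[n∸m]≡n 5≤D) (go (D ∸ 5))
  where
  go : ∀ j → suc (suc (suc ((5 + j) * (5 + j)))) ≤ 2 ^ (5 + j)
  go zero    = m≤m+n 28 4
  go (suc j) = begin
    suc (suc (suc ((6 + j) * (6 + j))))                              ≤⟨ m≤m+n _ (j * j + 8 * j + 17) ⟩
    suc (suc (suc ((6 + j) * (6 + j)))) + (j * j + 8 * j + 17)       ≡⟨ eq j ⟩
    2 * suc (suc (suc ((5 + j) * (5 + j))))                          ≤⟨ *-monoʳ-≤ 2 (go j) ⟩
    2 ^ (6 + j)                                                      ∎
    where
    open ≤-Reasoning
    eq : ∀ j → suc (suc (suc ((6 + j) * (6 + j)))) + (j * j + 8 * j + 17) ≡ 2 * suc (suc (suc ((5 + j) * (5 + j))))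
    eq = solve-∀

tower-mono : ∀ k {x y} → x ≤ y → tower k x ≤ tower k y
tower-mono zero    p = p
tower-mono (suc k) p = ^-monoʳ-≤ 2 (tower-mono k p)

tower-≥ : ∀ k x → x ≤ tower k x
tower-≥ zero    x = ≤-refl
tower-≥ (suc k) x = ≤-trans (tower-≥ k x) (≤-trans (n≤1+n _) (1+n≤2^n (tower k x)))

-- A power of the tower is a factor `e` in its top exponent, and there it is absorbed by an `e`-th
-- power; hence `suc e` in the recursion.
tower-^ : ∀ k e → ∃[ e′ ] ∀ x → 2 ≤ x → tower k x ^ e ≤ tower k (x ^ e′)
tower-^ zero    e = e , λ x _ → ≤-refl
tower-^ (suc k) e with tower-^ k (suc e)
... | e′ , h = e′ , λ x 2≤x → begin
  (2 ^ tower k x) ^ e        ≡⟨ ^-*-assoc 2 (tower k x) e ⟩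
  2 ^ (tower k x * e)        ≤⟨ ^-monoʳ-≤ 2 (*-monoʳ-≤ (tower k x) (≤-trans (n≤1+n e) (≤-trans (1+n≤2^n e) (^-monoˡ-≤ e (≤-trans 2≤x (tower-≥ k x)))))) ⟩
  2 ^ (tower k x ^ suc e)    ≤⟨ ^-monoʳ-≤ 2 (h x 2≤x) ⟩
  2 ^ tower k (x ^ e′)       ∎
  where open ≤-Reasoning

-- The exponent is a sum of payments in powers of `m`: `t + (2 * a + 2 * a)` for `suc used`, 2 for
-- `suc m`, and 3 for a factor 8 that absorbs the summand 5.
budget≤ : ∀ t a m used D → 2 ≤ m → used ≡ t * (suc (suc m) ^ a * suc (suc m) ^ a) → D ≡ 5 + suc used * suc m →
          D ≤ m ^ (t + (2 * a + 2 * a) + 2 + 3)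
budget≤ t a m used D 2≤m refl refl = begin
  5 + suc used * suc m                       ≤⟨ absorb (suc used * suc m) (s≤s z≤n) ⟩
  suc used * suc m * 8                       ≤⟨ *-mono-≤ (*-mono-≤ step m+1≤) (^-monoˡ-≤ 3 2≤m) ⟩
  m ^ (t + (2 * a + 2 * a)) * m ^ 2 * m ^ 3  ≡⟨ cong (_* m ^ 3) (^-distribˡ-+-* m (t + (2 * a + 2 * a)) 2) ⟨
  m ^ (t + (2 * a + 2 * a) + 2) * m ^ 3      ≡⟨ ^-distribˡ-+-* m (t + (2 * a + 2 * a) + 2) 3 ⟨
  m ^ (t + (2 * a + 2 * a) + 2 + 3)          ∎
  where
  open ≤-Reasoning
  absorb : ∀ x → 1 ≤ x → 5 + x ≤ x * 8
  absorb (suc x) _ = ≤-trans (m≤m+n (5 + suc x) (2 + 7 * x)) (≤-reflexive (eq x))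
    where
    eq : ∀ x → 5 + suc x + (2 + 7 * x) ≡ suc x * 8
    eq = solve-∀
  m+2≤ : suc (suc m) ≤ m ^ 2
  m+2≤ = begin
    2 + m        ≤⟨ +-monoˡ-≤ m 2≤m ⟩
    m + m        ≡⟨ cong (m +_) (+-identityʳ m) ⟨
    2 * m        ≤⟨ *-monoˡ-≤ m 2≤m ⟩
    m * m        ≡⟨ cong (m *_) (*-identityʳ m) ⟨
    m ^ 2        ∎
  m+1≤ : suc m ≤ m ^ 2
  m+1≤ = ≤-trans (n≤1+n _) m+2≤
  power : suc (suc m) ^ a ≤ m ^ (2 * a)
  power = ≤-trans (^-monoˡ-≤ a m+2≤) (≤-reflexive (^-*-assoc m 2 a))
  step : suc (t * (suc (suc m) ^ a * suc (suc m) ^ a)) ≤ m ^ (t + (2 * a + 2 * a))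
  step = begin
    1 + t * (suc (suc m) ^ a * suc (suc m) ^ a)    ≤⟨ +-mono-≤ (m^n>0 m {{>-nonZero (≤-trans (s≤s z≤n) 2≤m)}} (2 * a + 2 * a))
                                                        (*-monoʳ-≤ t (≤-trans (*-mono-≤ power power) (≤-reflexive (sym (^-distribˡ-+-* m (2 * a) (2 * a)))))) ⟩
    suc t * m ^ (2 * a + 2 * a)                    ≤⟨ *-monoˡ-≤ _ (≤-trans (1+n≤2^n t) (^-monoˡ-≤ t 2≤m)) ⟩
    m ^ t * m ^ (2 * a + 2 * a)                    ≡⟨ ^-distribˡ-+-* m t (2 * a + 2 * a) ⟨
    m ^ (t + (2 * a + 2 * a))                      ∎

enlarged≤ : ∀ n → 2 ≤ n → enlarged n ≤ n ^ 4
enlarged≤ n 2≤n = begin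
  enlarged n           ≡⟨ eq n ⟩
  3 * 2 + 2 * n        ≤⟨ +-monoˡ-≤ (2 * n) (*-monoʳ-≤ 3 2≤n) ⟩
  3 * n + 2 * n        ≤⟨ m≤m+n _ (3 * n) ⟩
  3 * n + 2 * n + 3 * n ≡⟨ eq′ n ⟩
  n * 8                ≤⟨ *-monoʳ-≤ n (^-monoˡ-≤ 3 2≤n) ⟩
  n ^ 4                ∎
  where
  open ≤-Reasoning
  eq : ∀ n → suc (suc ((n + 2) * 2)) ≡ 6 + 2 * n
  eq = solve-∀
  eq′ : ∀ n → 3 * n + 2 * n + 3 * n ≡ n * 8
  eq′ = solve-∀

2≤enlarged : ∀ n → 2 ≤ enlarged n
2≤enlarged n = s≤s (s≤s z≤n)

-- The induction on the size of the tuples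

Selects : ℕ → ℕ → ℕ → Set₁
Selects k r C = ∀ n → 2 ≤ n → ∀ {V : Set} {_≺_ : Rel V 0ℓ} → IsStrictTotalOrder _≡_ _≺_ →
  (F : Vec ℕ k → V) (fs : List (Vec ℕ (suc k) → ℕ)) → length fs ≡ r →
  ∀ Y → Asc Y → tower k (n ^ C) ≤ length Y → Injective F Y → Selection _≺_ F fs n Y

selects-zero : ∀ r → Selects 0 r (2 ^ r)
selects-zero r n _ sto F fs refl Y asc-Y large _ with windows fs n Y asc-Y large
... | X , X⊑Y , asc-X , len-X , uniform = record
  { X = X ; X⊑Y = X⊑Y ; asc = asc-X ; len = len-X ; uniform = uniform
  ; canonised = record { code = [] ; complete = λ () ; distinct = [] ; lex = λ _ _ _ _ () } }

-- One step of the induction passes from 2 ^ (D * D) points to m points below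
-- the limit; `used` bounds the number of colourings in force at any time.
record Sizes (k r n C₀ C used m D : ℕ) : Set where
  field
    recurse : tower k (enlarged n ^ C₀) ≤ m
    used≡   : used ≡ (3 + r) * (suc (suc m) ^ suc k * suc (suc m) ^ suc k)
    few     : suc (suc (suc (D * D))) ^ used ≤ 2 ^ (D * used)
    room    : suc (D * used) * suc m ≤ D * D
    fits    : D * D ≤ tower k (n ^ C)

few-colours : ∀ D used → 5 ≤ D → suc (suc (suc (D * D))) ^ used ≤ 2 ^ (D * used)
few-colours D used 5≤D = ≤-trans (^-monoˡ-≤ used (square<2^ D 5≤D)) (≤-reflexive (^-*-assoc 2 D used))

enough-room : ∀ D used m → 1 ≤ D → suc used * suc m ≤ D → suc (D * used) * suc m ≤ D * D
enough-room D used m 1≤D h = begin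
  suc (D * used) * suc m       ≤⟨ *-monoˡ-≤ (suc m) (+-monoˡ-≤ (D * used) 1≤D) ⟩
  (D + D * used) * suc m       ≡⟨ cong (_* suc m) (*-suc D used) ⟨
  D * suc used * suc m         ≡⟨ *-assoc D (suc used) (suc m) ⟩
  D * (suc used * suc m)       ≤⟨ *-monoʳ-≤ D h ⟩
  D * D                        ∎
  where open ≤-Reasoning

square-fits : ∀ k e e′ C₀ n D m → 2 ≤ n → (∀ x → 2 ≤ x → tower k x ^ (e * 2) ≤ tower k (x ^ e′)) →
  2 ≤ enlarged n ^ C₀ → m ≡ tower k (enlarged n ^ C₀) → D ≤ m ^ e → D * D ≤ tower k (n ^ (4 * (C₀ * e′)))
square-fits k e e′ C₀ n D m 2≤n h 2≤base refl D≤ = begin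
  D * D                                       ≤⟨ *-mono-≤ D≤ D≤ ⟩
  m ^ e * m ^ e                               ≡⟨ cong (m ^ e *_) (*-identityʳ (m ^ e)) ⟨
  (m ^ e) ^ 2                                 ≡⟨ ^-*-assoc m e 2 ⟩
  m ^ (e * 2)                                 ≤⟨ h (enlarged n ^ C₀) 2≤base ⟩
  tower k ((enlarged n ^ C₀) ^ e′)            ≡⟨ cong (tower k) (^-*-assoc (enlarged n) C₀ e′) ⟩
  tower k (enlarged n ^ (C₀ * e′))            ≤⟨ tower-mono k (^-monoˡ-≤ (C₀ * e′) (enlarged≤ n 2≤n)) ⟩
  tower k ((n ^ 4) ^ (C₀ * e′))               ≡⟨ cong (tower k) (^-*-assoc n 4 (C₀ * e′)) ⟩
  tower k (n ^ (4 * (C₀ * e′)))               ∎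
  where open ≤-Reasoning

sizes : ∀ k r C₀ → ∃[ C ] ∀ n → 2 ≤ n → ∃[ used ] ∃[ m ] ∃[ D ] Sizes k r n C₀ C used m D
sizes k r C₀ = go E refl (tower-^ k (E * 2))
  where
  E : ℕ
  E = 3 + r + (2 * suc k + 2 * suc k) + 2 + 3
  go : ∀ e → e ≡ 3 + r + (2 * suc k + 2 * suc k) + 2 + 3 →
       ∃[ e′ ] (∀ x → 2 ≤ x → tower k x ^ (e * 2) ≤ tower k (x ^ e′)) →
       ∃[ C ] ∀ n → 2 ≤ n → ∃[ used ] ∃[ m ] ∃[ D ] Sizes k r n C₀ C used m D
  -- `suc C₀` keeps the base of the tower at least 2 even if `C₀` is 0; the 4 comes from
  -- `enlarged≤`.
  go e e≡ (e′ , h) = 4 * (suc C₀ * e′) , λ n 2≤n → _ , _ , _ , mk n 2≤n _ refl _ refl _ refl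
    where
    mk : ∀ n → 2 ≤ n → ∀ m → m ≡ tower k (enlarged n ^ suc C₀) →
         ∀ used → used ≡ (3 + r) * (suc (suc m) ^ suc k * suc (suc m) ^ suc k) → ∀ D → D ≡ 5 + suc used * suc m →
         Sizes k r n C₀ (4 * (suc C₀ * e′)) used m D
    mk n 2≤n m m≡ used used≡ D D≡ = record
      { recurse = ≤-trans (tower-mono k (^-monoʳ-≤ (enlarged n) (n≤1+n C₀))) (≤-reflexive (sym m≡))
      ; used≡   = used≡
      ; few     = few-colours D used 5≤D
      ; room    = enough-room D used m (≤-trans (s≤s z≤n) 5≤D) (≤-trans (m≤n+m _ 5) (≤-reflexive (sym D≡)))
      ; fits    = square-fits k e e′ (suc C₀) n D m 2≤n h 2≤base m≡
                    (subst (λ e → D ≤ m ^ e) (sym e≡) (budget≤ (3 + r) (suc k) m used D 2≤m used≡ D≡))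
      }
      where
      5≤D : 5 ≤ D
      5≤D = ≤-trans (m≤m+n 5 (suc used * suc m)) (≤-reflexive (sym D≡))
      2≤base : 2 ≤ enlarged n ^ suc C₀
      2≤base = ≤-trans (2≤enlarged n) (m≤m*n (enlarged n) (enlarged n ^ C₀) {{m^n≢0 (enlarged n) C₀}})
      2≤m : 2 ≤ m
      2≤m = ≤-trans 2≤base (≤-trans (tower-≥ k _) (≤-reflexive (sym m≡)))

module SelectStep {k r n C₀ C used m D : ℕ} (ih : Selects k (auxiliary k r) C₀) (size : Sizes k r n C₀ C used m D)
  {V : Set} {_≺_ : Rel V 0ℓ} (sto : IsStrictTotalOrder _≡_ _≺_)
  (F : Vec ℕ (suc k) → V) (fs : List (Vec ℕ (suc (suc k)) → ℕ)) (len-fs : length fs ≡ r)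
  (Z : List ℕ) (asc-Z : Asc Z) (len-Z : length Z ≡ 2 ^ (D * D)) (injective : Injective F Z) where

  open Sizes size

  lim : Limit _≺_ F fs Z m
  lim = MakeLimit.limit sto F fs Z asc-Z (suc (D * D)) (D * used) m
    (subst (_< 2 ^ suc (D * D)) (sym len-Z) (^-monoʳ-< 2 ≤-refl {D * D} {suc (D * D)} ≤-refl))
    (subst (λ u → suc (suc (suc (D * D))) ^ u ≤ 2 ^ (D * used))
      (trans used≡ (cong (λ r → (3 + r) * (suc (suc m) ^ suc k * suc (suc m) ^ suc k)) (sym len-fs))) few)
    (≤-trans (^-monoʳ-≤ 2 room) (≤-reflexive (sym len-Z)))

  open Step sto F fs Z injective m n lim

  selection : Selection _≺_ F fs n Z
  selection = select (ih (enlarged n) (2≤enlarged n) sto G gs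
    (trans length-gs (cong (auxiliary k) len-fs)) (Limit.B lim) (Limit.asc lim)
    (≤-trans recurse (≤-reflexive (sym (Limit.len lim)))) injective-G)

selects-suc : ∀ k r C₀ C → Selects k (auxiliary k r) C₀ →
  (∀ n → 2 ≤ n → ∃[ used ] ∃[ m ] ∃[ D ] Sizes k r n C₀ C used m D) → Selects (suc k) r C
selects-suc k r C₀ C ih sizes n 2≤n sto F fs len-fs Y asc-Y large injective = from-sizes (sizes n 2≤n)
  where
  from-sizes : ∃[ used ] ∃[ m ] ∃[ D ] Sizes k r n C₀ C used m D → Selection _ F fs n Y
  -- Cut to exactly this length, because a longer list would have more scales and hence more
  -- colours.
  from-sizes (used , m , D , size) = from-split (split-asc (2 ^ (D * D)) asc-Y (≤-trans (^-monoʳ-≤ 2 (Sizes.fits size)) large))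
    where
    from-split : ∃[ Z ] ∃[ R ] Asc Z × Asc R × Z ⊑ Y × R ⊑ Y × length Z ≡ 2 ^ (D * D) ×
                   2 ^ (D * D) + length R ≡ length Y × (∀ {b r} → b ∈ Z → r ∈ R → b < r) → Selection _ F fs n Y
    from-split (Z , _ , asc-Z , _ , Z⊑Y , _ , len-Z , _) = record { Selection sel ; X⊑Y = Z⊑Y ∘ Selection.X⊑Y sel }
      where
      sel = SelectStep.selection ih size sto F fs len-fs Z asc-Z len-Z
        (λ {S} {T} dS iS dT iT → injective {S} {T} dS (Z⊑Y ∘ iS) dT (Z⊑Y ∘ iT))

select-canonical : ∀ k r → ∃[ C ] Selects k r C
select-canonical zero    r = 2 ^ r , selects-zero r
select-canonical (suc k) r with select-canonical k (auxiliary k r)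
... | C₀ , ih = proj₁ (sizes k r C₀) , selects-suc k r C₀ (proj₁ (sizes k r C₀)) ih (proj₂ (sizes k r C₀))

-- Exhaustive search

Searchable : Set → Set₁
Searchable A = ∀ {P : A → Set} → (∀ a → Dec (P a)) → Dec (∀ a → P a)

search-Bool : Searchable Bool
search-Bool P? = Dec.map (mk⇔ (λ (t , f) → λ { true → t ; false → f }) (λ h → h true , h false)) (P? true ×-dec P? false)

search-× : ∀ {A B} → Searchable A → Searchable B → Searchable (A × B)
search-× sA sB P? = Dec.map (mk⇔ (λ h (a , b) → h a b) (λ h a b → h (a , b))) (sA λ a → sB λ b → P? (a , b))

search-Vec : ∀ {A} n → Searchable A → Searchable (Vec A n)
search-Vec zero    sA P? = Dec.map (mk⇔ (λ p → λ { [] → p }) (λ h → h [])) (P? [])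
search-Vec (suc n) sA P? = Dec.map (mk⇔ (λ h → λ { (a ∷ v) → h a v }) (λ h a v → h (a ∷ v)))
  (sA λ a → search-Vec n sA λ v → P? (a ∷ v))

search-KSubset : ∀ {k N} → Searchable (KSubset k N)
search-KSubset {k} {N} {P} P? = Dec.map (mk⇔ (λ h (S , e) → h S e) (λ h S e → h (S , e))) (search-Vec N search-Bool at)
  where
  at : ∀ S → Dec (∀ (e : ∣ S ∣ ≡ k) → P (S , e))
  at S with ∣ S ∣ ≟ k
  ... | no ¬e = yes λ e → contradiction e ¬e
  ... | yes e = Dec.map (mk⇔ (λ p e′ → subst (λ e → P (S , e)) (≡-irrelevant e e′) p) (λ h → h e)) (P? (S , e))

KSubset-≡ : ∀ {k N} {S T : KSubset k N} → proj₁ S ≡ proj₁ T → S ≡ T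
KSubset-≡ {S = S , e} {.S , e′} refl = cong (S ,_) (≡-irrelevant e e′)

-- Functions on the subsets of Fin N as finite binary trees, so that they can
-- be searched exhaustively.
Table : ℕ → Set → Set
Table zero    A = A
Table (suc n) A = Table n A × Table n A

value : ∀ {n A} → Table n A → Subset n → A
value {zero}  t       []          = t
value {suc n} (t , u) (true ∷ S)  = value t S
value {suc n} (t , u) (false ∷ S) = value u S

table : ∀ {n A} → (Subset n → A) → Table n A
table {zero}  f = f []
table {suc n} f = table (f ∘ (true ∷_)) , table (f ∘ (false ∷_))

value-table : ∀ {n A} (f : Subset n → A) S → value (table f) S ≡ f S
value-table f []          = refl
value-table f (true ∷ S)  = value-table (f ∘ (true ∷_)) S
value-table f (false ∷ S) = value-table (f ∘ (false ∷_)) S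

search-Table : ∀ n {A} → Searchable A → Searchable (Table n A)
search-Table zero    sA = sA
search-Table (suc n) sA = search-× (search-Table n sA) (search-Table n sA)

module _ {k N : ℕ} where

  relation : Table N (Table N Bool) → Rel (KSubset k N) 0ℓ
  relation t S S′ = T (value (value t (proj₁ S)) (proj₁ S′))

  relation? : ∀ t S S′ → Dec (relation t S S′)
  relation? t S S′ = T? _

  -- Arbitrary relations cannot be enumerated, but a strict total order is decidable and so agrees
  -- with one of finitely many tables.
  tabulated : {_≺_ : Rel (KSubset k N) 0ℓ} → (∀ S S′ → Dec (S ≺ S′)) →
              ∃[ t ] (∀ S S′ → relation t S S′ ⇔ S ≺ S′)
  tabulated {_≺_} _≺?_ = t , correct
    where
    entry : Subset N → Subset N → Bool
    entry S S′ with ∣ S ∣ ≟ k | ∣ S′ ∣ ≟ k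
    ... | yes e | yes e′ = does ((S , e) ≺? (S′ , e′))
    ... | _     | _      = false
    t : Table N (Table N Bool)
    t = table λ S → table (entry S)
    t-entry : ∀ S S′ → value (value t S) S′ ≡ entry S S′
    t-entry S S′ = trans (cong (λ u → value u S′) (value-table (λ S → table (entry S)) S)) (value-table (entry S) S′)
    entry-correct : ∀ (S S′ : KSubset k N) → T (entry (proj₁ S) (proj₁ S′)) ⇔ S ≺ S′
    entry-correct (S , e) (S′ , e′) with ∣ S ∣ ≟ k | ∣ S′ ∣ ≟ k
    ... | no ¬e  | _       = contradiction e ¬e
    ... | yes _  | no ¬e′  = contradiction e′ ¬e′
    ... | yes e₁ | yes e₁′ rewrite ≡-irrelevant e₁ e | ≡-irrelevant e₁′ e′ with (S , e) ≺? (S′ , e′)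
    ...   | yes p = mk⇔ (λ _ → p) _
    ...   | no ¬p = mk⇔ (λ ()) ¬p
    correct : ∀ S S′ → relation t S S′ ⇔ S ≺ S′
    correct S S′ = subst (λ b → T b ⇔ S ≺ S′) (sym (t-entry (proj₁ S) (proj₁ S′))) (entry-correct S S′)

  -- Strict total orders in clauses that quantify over k-subsets only, so that each clause can be
  -- decided by search.
  Orders : Rel (KSubset k N) 0ℓ → Set
  Orders R = (∀ S → ¬ R S S) × (∀ S T U → R S T → R T U → R S U) × (∀ S T → S ≡ T ⊎ R S T ⊎ R T S)

  orders⇒strictTotal : ∀ {R} → Orders R → IsStrictTotalOrder _≡_ R
  orders⇒strictTotal {R} (irrefl , trans′ , total) = isStrictTotalOrderᶜ record
    { isEquivalence = isEquivalence ; trans = λ {S} {T} {U} → trans′ S T U ; compare = cmp }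
    where
    asym : ∀ {S T} → R S T → ¬ R T S
    asym p q = irrefl _ (trans′ _ _ _ p q)
    cmp : ∀ S T → Tri (R S T) (S ≡ T) (R T S)
    cmp S T with total S T
    ... | inj₁ refl     = tri≈ (irrefl S) refl (irrefl S)
    ... | inj₂ (inj₁ p) = tri< p (λ { refl → irrefl S p }) (asym p)
    ... | inj₂ (inj₂ p) = tri> (asym p) (λ { refl → irrefl S p }) p

  strictTotal⇒orders : ∀ {R} → IsStrictTotalOrder _≡_ R → Orders R
  strictTotal⇒orders {R} sto = (λ S → irrefl refl) , (λ S T U → trans′) , total
    where
    open IsStrictTotalOrder sto using (irrefl) renaming (trans to trans′; compare to cmp)
    total : ∀ S T → S ≡ T ⊎ R S T ⊎ R T S
    total S T with cmp S T
    ... | tri< p _ _ = inj₂ (inj₁ p)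
    ... | tri≈ _ p _ = inj₁ p
    ... | tri> _ _ p = inj₂ (inj₂ p)

  orders-⇔ : ∀ {R R′ : Rel (KSubset k N) 0ℓ} → (∀ S T → R S T ⇔ R′ S T) → Orders R′ → Orders R
  orders-⇔ e (irrefl , trans′ , total) =
    (λ S → irrefl S ∘ to (e S S)) ,
    (λ S T U p q → from (e S U) (trans′ S T U (to (e S T) p) (to (e T U) q))) ,
    λ S T → [ inj₁ , [ inj₂ ∘ inj₁ ∘ from (e S T) , inj₂ ∘ inj₂ ∘ from (e T S) ]′ ]′ (total S T)
    where open Equivalence

  orders? : ∀ {R} → (∀ S T → Dec (R S T)) → Dec (Orders R)
  orders? R? = search-KSubset (λ S → ¬? (R? S S)) ×-dec
    search-KSubset (λ S → search-KSubset λ T → search-KSubset λ U → R? S T →-dec R? T U →-dec R? S U) ×-dec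
    search-KSubset (λ S → search-KSubset λ T → (S ≟ₛ T) ⊎-dec R? S T ⊎-dec R? T S)
    where
    _≟ₛ_ : (S T : KSubset k N) → Dec (S ≡ T)
    S ≟ₛ T = Dec.map (mk⇔ KSubset-≡ (cong proj₁)) (Vec.≡-dec Bool._≟_ (proj₁ S) (proj₁ T))

  canonical-⇔ : ∀ {R R′ : Rel (KSubset k N) 0ℓ} {X} → (∀ S T → R S T ⇔ R′ S T) → Canonical R X → Canonical R′ X
  canonical-⇔ e can A B A⊆ B⊆ eq f op S S′ T T′ S⊆ S′⊆ im im′ p =
    Equivalence.to (e T T′) (can A B A⊆ B⊆ eq f op S S′ T T′ S⊆ S′⊆ im im′ (Equivalence.from (e S S′) p))

  orderPreserving? : ∀ A B (f : Fin N → Fin N) → Dec (OrderPreserving A B f)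
  orderPreserving? A B f = Dec.map
    (mk⇔ (λ (i , m) → record { maps-into = i _ ; monotone = m _ _ })
         (λ op → (λ x → OrderPreserving.maps-into op) , λ x y → OrderPreserving.monotone op))
    (Fin.all? (λ x → (x Subset.∈? A) →-dec (f x Subset.∈? B)) ×-dec
     Fin.all? (λ x → Fin.all? λ y → (x Subset.∈? A) →-dec (y Subset.∈? A) →-dec (x Fin.<? y) →-dec (f x Fin.<? f y)))

  isImage? : ∀ (f : Fin N → Fin N) S T → Dec (IsImage f S T)
  isImage? f S T = Fin.all? λ y → Dec.map (mk⇔ (λ (a , b) → mk⇔ a b) (λ e → Equivalence.to e , Equivalence.from e))
    (((y Subset.∈? T) →-dec image? y) ×-dec (image? y →-dec (y Subset.∈? T)))
    where
    image? : ∀ y → Dec (∃[ x ] (x ∈ₛ S × f x ≡ y))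
    image? y = Fin.any? λ x → (x Subset.∈? S) ×-dec (f x Fin.≟ y)

  -- Value vectors replace maps because they can be searched. Canonicity depends on a map only
  -- through its values, so nothing is lost.
  CanonicalVec : Rel (KSubset k N) 0ℓ → Subset N → Set
  CanonicalVec R X = (A B : Subset N) → A ⊆ X → B ⊆ X → ∣ A ∣ ≡ ∣ B ∣ →
    (v : Vec (Fin N) N) → OrderPreserving A B (lookup v) →
    (S S′ T T′ : KSubset k N) → proj₁ S ⊆ A → proj₁ S′ ⊆ A →
    IsImage (lookup v) (proj₁ S) (proj₁ T) → IsImage (lookup v) (proj₁ S′) (proj₁ T′) → R S S′ → R T T′

  canonicalVec⇒canonical : ∀ {R X} → CanonicalVec R X → Canonical R X
  canonicalVec⇒canonical can A B A⊆ B⊆ eq f op S S′ T T′ S⊆ S′⊆ im im′ p =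
    can A B A⊆ B⊆ eq (Vec.tabulate f) (tabulate-op op) S S′ T T′ S⊆ S′⊆
      (tabulate-image {S = proj₁ S} im) (tabulate-image {S = proj₁ S′} im′) p
    where
    tabulate-op : ∀ {A B f} → OrderPreserving A B f → OrderPreserving A B (lookup (Vec.tabulate f))
    tabulate-op {A} {B} {f} op = record
      { maps-into = λ {x} x∈ → subst (_∈ₛ B) (sym (Vec.lookup∘tabulate f x)) (maps-into x∈)
      ; monotone  = λ {x} {y} x∈ y∈ x<y → subst₂ Fin._<_ (sym (Vec.lookup∘tabulate f x)) (sym (Vec.lookup∘tabulate f y)) (monotone x∈ y∈ x<y) }
      where open OrderPreserving op
    tabulate-image : ∀ {f S T} → IsImage f S T → IsImage (lookup (Vec.tabulate f)) S T
    tabulate-image {f} im y = mk⇔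
      (λ y∈ → let (x , x∈ , e) = Equivalence.to (im y) y∈ in x , x∈ , trans (Vec.lookup∘tabulate f x) e)
      (λ (x , x∈ , e) → Equivalence.from (im y) (x , x∈ , trans (sym (Vec.lookup∘tabulate f x)) e))

  canonical⇒canonicalVec : ∀ {R X} → Canonical R X → CanonicalVec R X
  canonical⇒canonicalVec can A B A⊆ B⊆ eq v = can A B A⊆ B⊆ eq (lookup v)

  canonical? : ∀ {R : Rel (KSubset k N) 0ℓ} → (∀ S T → Dec (R S T)) → ∀ X → Dec (Canonical R X)
  canonical? {R} R? X = Dec.map (mk⇔ canonicalVec⇒canonical canonical⇒canonicalVec)
    (search-Vec N search-Bool λ A → search-Vec N search-Bool λ B →
      (A Subset.⊆? X) →-dec (B Subset.⊆? X) →-dec (∣ A ∣ ≟ ∣ B ∣) →-dec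
      search-Vec N Fin.all? λ v → orderPreserving? A B (lookup v) →-dec
      search-KSubset λ S → search-KSubset λ S′ → search-KSubset λ T → search-KSubset λ T′ →
      (proj₁ S Subset.⊆? A) →-dec (proj₁ S′ Subset.⊆? A) →-dec
      isImage? (lookup v) (proj₁ S) (proj₁ T) →-dec isImage? (lookup v) (proj₁ S′) (proj₁ T′) →-dec
      R? S S′ →-dec R? T T′)

CanonisableAt : ℕ → ℕ → ℕ → Set₁
CanonisableAt k n N = (_≺_ : Rel (KSubset k N) 0ℓ) → IsStrictTotalOrder _≡_ _≺_ → ∃[ X ] (∣ X ∣ ≡ n × Canonical _≺_ X)

canonisableAt? : ∀ k n N → Dec (CanonisableAt k n N)
canonisableAt? k n N = Dec.map (mk⇔ fromTables toTables) (search-Table N (search-Table N search-Bool) λ t →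
    orders? (relation? t) →-dec Subset.anySubset? λ X → (∣ X ∣ ≟ n) ×-dec canonical? (relation? t) X)
  where
  Tables : Set
  Tables = ∀ t → Orders (relation {k} {N} t) → ∃[ X ] (∣ X ∣ ≡ n × Canonical (relation {k} {N} t) X)
  fromTables : Tables → CanonisableAt k n N
  fromTables h _≺_ sto with tabulated (IsStrictTotalOrder._<?_ sto)
  ... | t , e with h t (orders-⇔ e (strictTotal⇒orders sto))
  ...   | X , len , can = X , len , canonical-⇔ e can
  toTables : CanonisableAt k n N → Tables
  toTables h t o = h (relation t) (orders⇒strictTotal o)

-- Descent from a valid bound: `suc M` can be lowered to `M` if `M` itself is canonisable; otherwise
-- every bound exceeds `M`.
leeb-number : ∀ k n M → LeebBound k n M → ∃[ L ] (IsLeebNumber k n L × L ≤ M)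
leeb-number k n zero    b = 0 , record { bound = b ; least = λ _ _ → z≤n } , z≤n
leeb-number k n (suc M) b with canonisableAt? k n M
... | no ¬c = suc M , record { bound = b ; least = λ M′ b′ → ≰⇒> λ M′≤M → ¬c (b′ M M′≤M) } , ≤-refl
... | yes c with leeb-number k n M (λ N M≤N → [ b N , (λ { refl → c }) ]′ (m≤n⇒m<n∨m≡n M≤N))
...   | L , leeb , L≤M = L , leeb , m≤n⇒m≤1+n L≤M

-- Subsets and decreasing tuples

infix 4 _∈ᵥ_
_∈ᵥ_ : ∀ {A : Set} {k} → A → Vec A k → Set
x ∈ᵥ v = ∃[ i ] lookup v i ≡ x

-- The heads are the maxima of the two sets; removing them leaves equal sets. The lengths may differ
-- a priori, so that equality of cardinalities is a consequence, `desc-length`.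
desc-unique : ∀ {k l} (S : Vec ℕ k) (T : Vec ℕ l) → Desc S → Desc T →
  (∀ {x} → x ∈ᵥ S → x ∈ᵥ T) → (∀ {x} → x ∈ᵥ T → x ∈ᵥ S) → Vec.toList S ≡ Vec.toList T
desc-unique []      []      _  _  _ _ = refl
desc-unique []      (y ∷ T) _  _  _ h with h (zero , refl)
... | ()
desc-unique (x ∷ S) []      _  _  h _ with h (zero , refl)
... | ()
desc-unique (x ∷ S) (y ∷ T) dS dT h h′ = cong₂ _∷_ x≡y
  (desc-unique S T (desc-tail dS) (desc-tail dT) (strip dS h x≡y) (strip dT h′ (sym x≡y)))
  where
  top : ∀ {k x y} {S : Vec ℕ k} → Desc (x ∷ S) → y ∈ᵥ (x ∷ S) → y ≤ x
  top d (zero  , refl) = ≤-refl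
  top d (suc i , refl) = <⇒≤ (desc-head d i)
  x≡y : x ≡ y
  x≡y = ≤-antisym (top dT (h (zero , refl))) (top dS (h′ (zero , refl)))
  strip : ∀ {k l x y} {S : Vec ℕ k} {T : Vec ℕ l} → Desc (x ∷ S) → (∀ {z} → z ∈ᵥ (x ∷ S) → z ∈ᵥ (y ∷ T)) →
          x ≡ y → ∀ {z} → z ∈ᵥ S → z ∈ᵥ T
  strip d h refl (i , refl) with h (suc i , refl)
  ... | zero  , e = contradiction e (λ e → <-irrefl (sym e) (desc-head d i))
  ... | suc j , e = j , e

desc-length : ∀ {k l} (S : Vec ℕ k) (T : Vec ℕ l) → Desc S → Desc T →
  (∀ {x} → x ∈ᵥ S → x ∈ᵥ T) → (∀ {x} → x ∈ᵥ T → x ∈ᵥ S) → k ≡ l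
desc-length S T dS dT h h′ = trans (sym (Vec.length-toList S))
  (trans (cong length (desc-unique S T dS dT h h′)) (Vec.length-toList T))

desc-≡ : ∀ {k} (S T : Vec ℕ k) → Desc S → Desc T →
  (∀ {x} → x ∈ᵥ S → x ∈ᵥ T) → (∀ {x} → x ∈ᵥ T → x ∈ᵥ S) → S ≡ T
desc-≡ S T dS dT h h′ = trans (sym (take-vec-toList S)) (trans (cong (take-vec _) (desc-unique S T dS dT h h′)) (take-vec-toList T))

∷ʳ⁻ : ∀ {A : Set} {k} (v : Vec A k) {x y} → x ∈ᵥ (v Vec.∷ʳ y) → x ∈ᵥ v ⊎ x ≡ y
∷ʳ⁻ []      (zero  , e) = inj₂ (sym e)
∷ʳ⁻ (a ∷ v) (zero  , e) = inj₁ (zero , e)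
∷ʳ⁻ (a ∷ v) (suc i , e) with ∷ʳ⁻ v (i , e)
... | inj₁ (j , e′) = inj₁ (suc j , e′)
... | inj₂ e′       = inj₂ e′

∷ʳ⁺ : ∀ {A : Set} {k} (v : Vec A k) {x y} → x ∈ᵥ v → x ∈ᵥ (v Vec.∷ʳ y)
∷ʳ⁺ (a ∷ v) (zero  , e) = zero , e
∷ʳ⁺ (a ∷ v) (suc i , e) with ∷ʳ⁺ v (i , e)
... | j , e′ = suc j , e′

∷ʳ-last : ∀ {A : Set} {k} (v : Vec A k) {y} → y ∈ᵥ (v Vec.∷ʳ y)
∷ʳ-last []      = zero , refl
∷ʳ-last (a ∷ v) with ∷ʳ-last v
... | j , e = suc j , e

desc-∷ʳ : ∀ {k} (S : Vec ℕ k) {y} → Desc S → (∀ i → y < lookup S i) → Desc (S Vec.∷ʳ y)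
desc-∷ʳ []      {y} d h {zero} {zero} ()
desc-∷ʳ (x ∷ S) {y} d h = desc-∷ bound (desc-∷ʳ S (desc-tail d) (h ∘ suc))
  where
  bound : x ≫ (S Vec.∷ʳ y)
  bound i with ∷ʳ⁻ S (i , refl)
  ... | inj₁ (j , e) = subst (_< x) e (desc-head d j)
  ... | inj₂ e       = subst (_< x) (sym e) (h zero)

descending : (X : List ℕ) → Vec ℕ (length X)
descending []      = []
descending (x ∷ X) = descending X Vec.∷ʳ x

∈-descending⁻ : ∀ X {x} → x ∈ᵥ descending X → x ∈ X
∈-descending⁻ (y ∷ X) i with ∷ʳ⁻ (descending X) i
... | inj₁ j = there (∈-descending⁻ X j)
... | inj₂ e = here e

desc-descending : ∀ {X} → Asc X → Desc (descending X)
desc-descending {[]}    []         {()}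
desc-descending {x ∷ X} (x< ∷ asc) = desc-∷ʳ (descending X) (desc-descending asc) (λ i → All.lookup x< (∈-descending⁻ X (i , refl)))

values : ∀ {N k} → Vec (Fin N) k → Vec ℕ k
values = Vec.map Fin.toℕ

∈-values⁻ : ∀ {N k x} {v : Vec (Fin N) k} → x ∈ᵥ values v → ∃[ y ] y ∈ᵥ v × Fin.toℕ y ≡ x
∈-values⁻ {v = v} (i , e) = lookup v i , (i , refl) , trans (sym (Vec.lookup-map i Fin.toℕ v)) e

∈-values⁺ : ∀ {N k y} {v : Vec (Fin N) k} → y ∈ᵥ v → Fin.toℕ y ∈ᵥ values v
∈-values⁺ {v = v} (i , refl) = i , Vec.lookup-map i Fin.toℕ v

module _ {N : ℕ} where

  fromVec : ∀ {k} → Vec ℕ k → Subset N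
  fromVec v = Vec.tabulate λ x → does (Fin.any? λ i → lookup v i ≟ Fin.toℕ x)

  ∈-fromVec : ∀ {k x} {v : Vec ℕ k} → x ∈ₛ fromVec v ⇔ Fin.toℕ x ∈ᵥ v
  ∈-fromVec {x = x} {v} = mk⇔
    (λ x∈ → decided (trans (sym (Vec.lookup∘tabulate _ x)) (Vec.[]=⇒lookup x∈)))
    (λ x∈ → Vec.lookup⇒[]= x _ (trans (Vec.lookup∘tabulate _ x) (Dec.dec-true (Fin.any? λ i → lookup v i ≟ Fin.toℕ x) x∈)))
    where
    decided : does (Fin.any? λ i → lookup v i ≟ Fin.toℕ x) ≡ true → Fin.toℕ x ∈ᵥ v
    decided e with Fin.any? (λ i → lookup v i ≟ Fin.toℕ x)
    ... | yes p = p

elements : ∀ {N} (S : Subset N) → Vec (Fin N) ∣ S ∣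
elements []          = []
elements (true  ∷ S) = Vec.map suc (elements S) Vec.∷ʳ zero
elements (false ∷ S) = Vec.map suc (elements S)

∈-map-suc⁻ : ∀ {N k} (v : Vec (Fin N) k) {x} → x ∈ᵥ Vec.map suc v → ∃[ y ] y ∈ᵥ v × suc y ≡ x
∈-map-suc⁻ v (i , e) = lookup v i , (i , refl) , trans (sym (Vec.lookup-map i suc v)) e

∈-map-suc⁺ : ∀ {N k} (v : Vec (Fin N) k) {y} → y ∈ᵥ v → suc y ∈ᵥ Vec.map suc v
∈-map-suc⁺ v (i , refl) = i , Vec.lookup-map i suc v

∈-elements⁻ : ∀ {N} (S : Subset N) {x} → x ∈ᵥ elements S → x ∈ₛ S
∈-elements⁻ [] (() , _)
∈-elements⁻ (true ∷ S) i with ∷ʳ⁻ (Vec.map suc (elements S)) i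
... | inj₂ refl = Vec.here
... | inj₁ j with ∈-map-suc⁻ (elements S) j
...   | y , y∈ , refl = Vec.there (∈-elements⁻ S y∈)
∈-elements⁻ (false ∷ S) i with ∈-map-suc⁻ (elements S) i
... | y , y∈ , refl = Vec.there (∈-elements⁻ S y∈)

∈-elements⁺ : ∀ {N} (S : Subset N) {x} → x ∈ₛ S → x ∈ᵥ elements S
∈-elements⁺ (true ∷ S)  Vec.here       = ∷ʳ-last (Vec.map suc (elements S))
∈-elements⁺ (true ∷ S)  (Vec.there x∈) = ∷ʳ⁺ (Vec.map suc (elements S)) (∈-map-suc⁺ (elements S) (∈-elements⁺ S x∈))
∈-elements⁺ (false ∷ S) (Vec.there x∈) = ∈-map-suc⁺ (elements S) (∈-elements⁺ S x∈)

DescFin : ∀ {N k} → Vec (Fin N) k → Set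
DescFin v = ∀ {i j} → i Fin.< j → lookup v j Fin.< lookup v i

desc-values : ∀ {N k} {v : Vec (Fin N) k} → DescFin v → Desc (values v)
desc-values {v = v} d {i} {j} p = subst₂ _<_ (sym (Vec.lookup-map j Fin.toℕ v)) (sym (Vec.lookup-map i Fin.toℕ v)) (d p)

desc-values-suc : ∀ {N k} {v : Vec (Fin N) k} → Desc (values v) → Desc (values (Vec.map suc v))
desc-values-suc {v = v} d {i} {j} p = subst₂ _<_ (eq j) (eq i) (s≤s (d p))
  where
  eq : ∀ i → suc (lookup (values v) i) ≡ lookup (values (Vec.map suc v)) i
  eq i = trans (cong suc (Vec.lookup-map i Fin.toℕ v))
    (sym (trans (Vec.lookup-map i Fin.toℕ (Vec.map suc v)) (cong Fin.toℕ (Vec.lookup-map i suc v))))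

desc-elements : ∀ {N} (S : Subset N) → Desc (values (elements S))
desc-elements []          {()}
desc-elements (false ∷ S) = desc-values-suc {v = elements S} (desc-elements S)
desc-elements (true ∷ S)  = subst Desc (sym (Vec.map-∷ʳ Fin.toℕ zero (Vec.map suc (elements S))))
  (desc-∷ʳ (values (Vec.map suc (elements S))) (desc-values-suc {v = elements S} (desc-elements S)) positive)
  where
  positive : ∀ i → 0 < lookup (values (Vec.map suc (elements S))) i
  positive i with ∈-values⁻ {v = Vec.map suc (elements S)} (i , refl)
  ... | y , y∈ , e with ∈-map-suc⁻ (elements S) y∈
  ...   | _ , _ , refl = subst (0 <_) e z<s

members : ∀ {k N} → KSubset k N → Vec (Fin N) k
members (S , refl) = elements S

desc-members : ∀ {k N} (S : KSubset k N) → Desc (values (members S))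
desc-members (S , refl) = desc-elements S

∈-members⁻ : ∀ {k N} (S : KSubset k N) {x} → x ∈ᵥ members S → x ∈ₛ proj₁ S
∈-members⁻ (S , refl) = ∈-elements⁻ S

∈-members⁺ : ∀ {k N} (S : KSubset k N) {x} → x ∈ₛ proj₁ S → x ∈ᵥ members S
∈-members⁺ (S , refl) = ∈-elements⁺ S

card-fromVec : ∀ {N k} (v : Vec ℕ k) → Desc v → (∀ i → lookup v i < N) → ∣ fromVec {N} v ∣ ≡ k
card-fromVec {N} v d bound = desc-length (values (elements S)) v (desc-elements S) d to from
  where
  S : Subset N
  S = fromVec v
  to : ∀ {x} → x ∈ᵥ values (elements S) → x ∈ᵥ v
  to i with ∈-values⁻ {v = elements S} i
  ... | y , y∈ , refl = Equivalence.to (∈-fromVec {v = v}) (∈-elements⁻ S y∈)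
  from : ∀ {x} → x ∈ᵥ v → x ∈ᵥ values (elements S)
  from (i , refl) = subst (_∈ᵥ values (elements S)) (Fin.toℕ-fromℕ< (bound i))
    (∈-values⁺ {v = elements S} (∈-elements⁺ S (Equivalence.from (∈-fromVec {v = v}) (i , sym (Fin.toℕ-fromℕ< (bound i))))))

-- Transfer from tuples to subsets

module Bridge {k N : ℕ} {_≺_ : Rel (KSubset k N) 0ℓ} (sto : IsStrictTotalOrder _≡_ _≺_) where

  open Infimum _≺_ using (_<₋_)
  open IsStrictTotalOrder sto using (irrefl; asym)

  sto₋ : IsStrictTotalOrder _≡_ _<₋_
  sto₋ = Infimum.<₋-isStrictTotalOrder-≡ _≺_ sto

  -- Vectors that do not represent a k-subset get the junk value ⊥₋.
  embed : Subset N → KSubset k N ₋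
  embed S with ∣ S ∣ ≟ k
  ... | yes e = [ S , e ]
  ... | no  _ = ⊥₋

  embed-≡ : ∀ {S} (e : ∣ S ∣ ≡ k) → embed S ≡ [ S , e ]
  embed-≡ {S} e with ∣ S ∣ ≟ k
  ... | yes e′ = cong [_] (KSubset-≡ refl)
  ... | no ¬e  = contradiction e ¬e

  F : Vec ℕ k → KSubset k N ₋
  F v = embed (fromVec v)

  F-members : ∀ S → F (values (members S)) ≡ [ S ]
  F-members S = trans (cong embed (Subset.⊆-antisym back forth)) (embed-≡ (proj₂ S))
    where
    back : fromVec (values (members S)) ⊆ proj₁ S
    back x∈ with ∈-values⁻ {v = members S} (Equivalence.to (∈-fromVec {v = values (members S)}) x∈)
    ... | y , y∈ , e = subst (_∈ₛ proj₁ S) (Fin.toℕ-injective e) (∈-members⁻ S y∈)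
    forth : proj₁ S ⊆ fromVec (values (members S))
    forth x∈ = Equivalence.from (∈-fromVec {v = values (members S)}) (∈-values⁺ {v = members S} (∈-members⁺ S x∈))

  ground-< : ∀ {v : Vec ℕ k} → v ⊏ upTo N → ∀ i → lookup v i < N
  ground-< h i with ∈-upTo⁻ (h i)
  ... | p = p

  -- Decreasing tuples over the ground set represent genuine k-subsets, so the junk value does not
  -- occur, and such a tuple is determined by its set.
  injective-F : Injective F (upTo N)
  injective-F {S} {T} dS iS dT iT e = desc-≡ S T dS dT (along S T iS sets) (along T S iT (sym sets))
    where
    cS = card-fromVec S dS (ground-< {S} iS)
    cT = card-fromVec T dT (ground-< {T} iT)
    sets : fromVec {N} S ≡ fromVec T
    sets = cong proj₁ ([]-injective (trans (sym (embed-≡ cS)) (trans e (embed-≡ cT))))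
    along : ∀ (S T : Vec ℕ k) → S ⊏ upTo N → fromVec {N} S ≡ fromVec T → ∀ {x} → x ∈ᵥ S → x ∈ᵥ T
    along S T iS e (i , refl) = subst (_∈ᵥ T) (Fin.toℕ-fromℕ< p)
      (Equivalence.to (∈-fromVec {v = T}) (subst (Fin.fromℕ< p ∈ₛ_) e (Equivalence.from (∈-fromVec {v = S}) (i , sym (Fin.toℕ-fromℕ< p)))))
      where p = ground-< {S} iS i

  module _ {X : List ℕ} (asc : Asc X) (X⊑ : X ⊑ upTo N) (canonised : Canonised _<₋_ F X) where

    open Canonised canonised

    chosen : Subset N
    chosen = fromVec (descending X)

    card-chosen : ∣ chosen ∣ ≡ length X
    card-chosen = card-fromVec {N} (descending X) (desc-descending asc) (λ i → ∈-upTo⁻ (X⊑ (∈-descending⁻ X (i , refl))))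

    ∈-chosen : ∀ {x} → x ∈ₛ chosen → Fin.toℕ x ∈ X
    ∈-chosen x∈ = ∈-descending⁻ X (Equivalence.to (∈-fromVec {v = descending X}) x∈)

    members-⊏ : ∀ (S : KSubset k N) → proj₁ S ⊆ chosen → values (members S) ⊏ X
    members-⊏ S S⊆ i with ∈-values⁻ {v = members S} (i , refl)
    ... | y , y∈ , e = subst (_∈ X) e (∈-chosen (S⊆ (∈-members⁻ S y∈)))

    lex⇒≺ : ∀ {S T} → proj₁ S ⊆ chosen → proj₁ T ⊆ chosen → Lex code (values (members S)) (values (members T)) → S ≺ T
    lex⇒≺ {S} {T} S⊆ T⊆ l with subst₂ _<₋_ (F-members S) (F-members T)
      (lex {values (members S)} {values (members T)} (desc-members S) (members-⊏ S S⊆) (desc-members T) (members-⊏ T T⊆) l)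
    ... | Infimum.[ p ] = p

    ≺⇒lex : ∀ {S T} → proj₁ S ⊆ chosen → proj₁ T ⊆ chosen → S ≺ T → Lex code (values (members S)) (values (members T))
    ≺⇒lex {S} {T} S⊆ T⊆ S≺T with lex-cmp code (values (members S)) (values (members T))
    ... | inj₂ (inj₁ l) = l
    ... | inj₂ (inj₂ l) = contradiction S≺T (asym (lex⇒≺ {T} {S} T⊆ S⊆ l))
    ... | inj₁ ag = contradiction S≺T (irrefl ([]-injective
            (trans (sym (F-members S)) (trans (cong F (agree-complete {S = values (members S)} {values (members T)} complete ag)) (F-members T)))))

    -- A lexicographic comparison is built from comparisons and equalities of single entries, which
    -- an order-preserving map respects. This is why lexicographic orderings are canonical.
    lex-image : ∀ (c : Code k) {A B f} → OrderPreserving A B f → (S T : KSubset k N) → proj₁ S ⊆ A → proj₁ T ⊆ A →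
      Lex c (values (members S)) (values (members T)) →
      Lex c (values (Vec.map f (members S))) (values (Vec.map f (members T)))
    lex-image ((p , s) ∷ c) {A} {B} {f} op S T S⊆ T⊆ l = step l
      where
      open OrderPreserving op
      value-at : ∀ (v : Vec (Fin N) k) → lookup (values v) p ≡ Fin.toℕ (lookup v p)
      value-at v = Vec.lookup-map p Fin.toℕ v
      image-at : ∀ (v : Vec (Fin N) k) → lookup (values (Vec.map f v)) p ≡ Fin.toℕ (f (lookup v p))
      image-at v = trans (value-at (Vec.map f v)) (cong Fin.toℕ (Vec.lookup-map p f v))
      x y : Fin N
      x = lookup (members S) p
      y = lookup (members T) p
      x∈ : x ∈ₛ A
      x∈ = S⊆ (∈-members⁻ S (p , refl))
      y∈ : y ∈ₛ A
      y∈ = T⊆ (∈-members⁻ T (p , refl))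
      mono : ∀ s → Fin.toℕ x <[ s ] Fin.toℕ y → Fin.toℕ (f x) <[ s ] Fin.toℕ (f y)
      mono true  = monotone x∈ y∈
      mono false = monotone y∈ x∈
      step : Lex ((p , s) ∷ c) (values (members S)) (values (members T)) →
             Lex ((p , s) ∷ c) (values (Vec.map f (members S))) (values (Vec.map f (members T)))
      step (inj₁ l) = inj₁ (subst₂ (_<[ s ]_) (sym (image-at (members S))) (sym (image-at (members T)))
        (mono s (subst₂ (_<[ s ]_) (value-at (members S)) (value-at (members T)) l)))
      step (inj₂ (e , l)) = inj₂
        (trans (image-at (members S)) (trans (cong (Fin.toℕ ∘ f)
          (Fin.toℕ-injective (trans (sym (value-at (members S))) (trans e (value-at (members T)))))) (sym (image-at (members T)))) ,
         lex-image c op S T S⊆ T⊆ l)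

    -- Applying `f` entrywise keeps the enumeration decreasing, so both sides list the same set in
    -- the same order.
    members-image : ∀ {A B f} → OrderPreserving A B f → (S T : KSubset k N) → proj₁ S ⊆ A → IsImage f (proj₁ S) (proj₁ T) →
      values (Vec.map f (members S)) ≡ values (members T)
    members-image {A} {B} {f} op S T S⊆ im = desc-≡ _ _ (desc-values {v = Vec.map f (members S)} desc) (desc-members T) to from
      where
      open OrderPreserving op
      v = members S
      ∈A : ∀ i → lookup v i ∈ₛ A
      ∈A i = S⊆ (∈-members⁻ S (i , refl))
      desc : DescFin (Vec.map f v)
      desc {i} {j} p = subst₂ Fin._<_ (sym (Vec.lookup-map j f v)) (sym (Vec.lookup-map i f v))
        (monotone (∈A j) (∈A i) (subst₂ _<_ (Vec.lookup-map j Fin.toℕ v) (Vec.lookup-map i Fin.toℕ v) (desc-members S p)))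
      to : ∀ {x} → x ∈ᵥ values (Vec.map f v) → x ∈ᵥ values (members T)
      to i with ∈-values⁻ {v = Vec.map f v} i
      ... | y , (j , e) , refl = ∈-values⁺ {v = members T} (∈-members⁺ T (Equivalence.from (im y)
              (lookup v j , ∈-members⁻ S (j , refl) , trans (sym (Vec.lookup-map j f v)) e)))
      from : ∀ {x} → x ∈ᵥ values (members T) → x ∈ᵥ values (Vec.map f v)
      from i with ∈-values⁻ {v = members T} i
      ... | y , y∈ , refl with Equivalence.to (im y) (∈-members⁻ T y∈)
      ...   | x , x∈ , refl with ∈-members⁺ S x∈
      ...     | j , e = ∈-values⁺ {v = Vec.map f v} (j , trans (Vec.lookup-map j f v) (cong f e))

    image-⊆ : ∀ {A B S T : Subset N} {f} → OrderPreserving A B f → S ⊆ A → IsImage f S T → T ⊆ B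
    image-⊆ op S⊆ im {y} y∈ with Equivalence.to (im y) y∈
    ... | x , x∈ , refl = OrderPreserving.maps-into op (S⊆ x∈)

    canonical-chosen : Canonical _≺_ chosen
    canonical-chosen A B A⊆ B⊆ _ f op S S′ T T′ S⊆ S′⊆ im im′ S≺S′ =
      lex⇒≺ {T} {T′} (B⊆ ∘ image-⊆ {S = proj₁ S} {proj₁ T} op S⊆ im) (B⊆ ∘ image-⊆ {S = proj₁ S′} {proj₁ T′} op S′⊆ im′)
        (subst₂ (Lex code) (members-image op S T S⊆ im) (members-image op S′ T′ S′⊆ im′)
          (lex-image code op S S′ S⊆ S′⊆ (≺⇒lex {S} {S′} (A⊆ ∘ S⊆) (A⊆ ∘ S′⊆) S≺S′)))

-- For n = 1 the power n ^ C cannot absorb any constants.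
leebBound-one : ∀ k → 2 ≤ k → LeebBound k 1 1
leebBound-one k 2≤k (suc N) _ _≺_ sto = X , card , λ A B A⊆ B⊆ _ f op S S′ T T′ S⊆ S′⊆ im im′ _ →
  contradiction (≤-trans (≤-reflexive (sym (proj₂ S))) (Subset.p⊆q⇒∣p∣≤∣q∣ (A⊆ ∘ S⊆)))
                (<⇒≱ (subst (_< k) (sym card) 2≤k))
  where
  X : Subset (suc N)
  X = ⁅ zero ⁆
  card : ∣ X ∣ ≡ 1
  card = Subset.∣⁅x⁆∣≡1 {suc N} zero

leebBound-tower : ∀ {k C n} → Selects k 0 C → 2 ≤ n → LeebBound k n (tower k (n ^ C))
leebBound-tower {k} {C} {n} selects 2≤n N large _≺_ sto = chosen asc X⊑Y canonised ,
  trans (card-chosen asc X⊑Y canonised) len , canonical-chosen asc X⊑Y canonised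
  where
  open Bridge sto
  open Selection (selects n 2≤n sto₋ F [] refl (upTo N) (AllPairs.applyUpTo⁺₁ id N (λ p _ → p))
    (≤-trans large (≤-reflexive (sym (List.length-upTo N)))) injective-F)

theorem1p4 : ∀ (k : ℕ) → 2 ≤ k →
    ∃[ C ] (∀ (n : ℕ) → 1 ≤ n →
    ∃[ L ] (IsLeebNumber k n L × L ≤ tower k (n ^ C)))
theorem1p4 k 2≤k = C , bounds
  where
  C : ℕ
  C = proj₁ (select-canonical k 0)
  bounds : ∀ n → 1 ≤ n → ∃[ L ] (IsLeebNumber k n L × L ≤ tower k (n ^ C))
  bounds 1 _ with leeb-number k 1 1 (leebBound-one k 2≤k)
  ... | L , leeb , L≤1 = L , leeb , ≤-trans L≤1 (≤-trans (m^n>0 1 C) (tower-≥ k (1 ^ C)))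
  bounds n@(suc (suc _)) _ = leeb-number k n (tower k (n ^ C)) (leebBound-tower {k} {C} {n} (proj₂ (select-canonical k 0)) (s≤s (s≤s z≤n)))
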